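{- Let $T$ be a reflexive tree and let $\sigma$ be a voltage assignment on $T$ with values in $\mathbb{Z}_n$. Suppose that $(T,\sigma)$ can be odd shifting decomposed into paths $\{Q_1,\dots,Q_k\}$ whose common endpoint voltage is coprime to $n$. If $(T,\sigma)$ is properly weighted, then the covering graph $T^{\sigma}$ is Hamiltonian.
   Context: Voltage graphs and lifts: for a graph $\Gamma$ (loops allowed), each edge $[u,v]$ gives two arcs $(u,v),(v,u)$; a loop $[v,v]$ gives two arcs $(v,v)$, one called primary and one secondary. A voltage assignment is a map $\sigma$ from the arcs to a group $G$ with $\sigma(v,u)=-\sigma(u,v)$ and with the two arcs of a loop receiving inverse elements; $\sigma(v)$ denotes the value on the primary loop at $v$. The covering graph (lift) $\Gamma^\sigma$ has vertex set $V(\Gamma)\times G$, and $(u,a)$ is adjacent to $(v,b)$ iff there is an arc $(u,v)$ with $\sigma(u,v)=b-a$ (here $G=\mathbb{Z}_n$, written additively). The fiber $v^\sigma$ is the subgraph of $\Gamma^\sigma$ induced by $\{(v,g):g\in G\}$. A graph is reflexive if it has exactly one loop at every vertex. Extended billiard strategy: let $\Gamma=(v_1,\dots,v_m)$, $m\ge 2$, be a reflexive path with voltage assignment $\sigma$ into $\mathbb{Z}_n$, let $r\in\mathbb{Z}_n$, $l\in\mathbb{Z}_n$, and let $d$ be an integer with $1\le d\le n/\gcd(r,n)$. Start with paths $P_j$ ($0\le j\le d-1$) consisting of the single vertex $(v_1,l+jr)$, and set $x_j=l+jr$. For $t=1,\dots,m-1$ do: if $t=1$ put $y_j=x_j$;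 if $t\ge 2$, let $a=\sigma(v_t)$ and $X=\{x_0,\dots,x_{d-1}\}$ (the values at which the paths arrived in $v_t^\sigma$), let $s_j\ge 0$ be least with $x_j+(s_j+1)a\in X$, extend $P_j$ by the vertices $(v_t,x_j+a),\dots,(v_t,x_j+s_ja)$ and put $y_j=x_j+s_ja$. Then extend each $P_j$ by the edge from $(v_t,y_j)$ to $(v_{t+1},y_j+\sigma(v_t,v_{t+1}))$ and put $x_j:=y_j+\sigma(v_t,v_{t+1})$. The final $x_j$ is the value at which $P_j$ arrives in $v_m^\sigma$. For such $\Gamma$ define $\mathrm{c}(\Gamma)=1$ if $m=2$, and $\mathrm{c}(\Gamma)=\lceil \tfrac12\max\{\gcd(n,\sigma(v_t)):2\le t\le m-1\}\rceil$ if $m\ge 3$ (with $\gcd(n,0)=n$). Odd shifting path: $(\Gamma,\sigma)$ with $\sigma(v_1)=\sigma(v_m)=r$ (the endpoint voltage) is an odd shifting path if, with $d=2\mathrm{c}(\Gamma)\le n/\gcd(r,n)$, step $r$ and $l=0$, the family produced by the extended billiard strategy satisfies: there is an odd integer $0<s<d$ such that, writing $(a_0,\dots,a_{d-1})=(d-s,d-s+1,\dots,d-1,0,1,\dots,d-s-1)$ and $\beta=l+\sum_{t=1}^{m-1}\sigma(v_t,v_{t+1})-\sum_{t=2}^{m-1}\sigma(v_t)$, the path $P_{a_k}$ arrives in $v_m^\sigma$ at $(v_m,\beta+kr)$ for each $k=0,\dots,d-1$. (A path of $T$ is called odd shifting if, with its vertices in some order, the reflexive path formed by its vertices, edges and loops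 with the restriction of $\sigma$ is odd shifting.) Odd shifting decomposition: $T$ (with loop set $L$) can be odd shifting decomposed into $\{Q_1,\dots,Q_k\}$ if each $Q_i$ is an odd shifting path in $T$, the sets $E(Q_i)\setminus L$ partition $E(T)\setminus L$, and for $i\ne j$ every vertex common to $Q_i$ and $Q_j$ is an endpoint of both. A joint is an endpoint of some $Q_i$. For an endpoint $u$ of $Q_i$ set $\omega_{Q_i}(u)=2\mathrm{c}(Q_i)$, and for a joint $v$ let $\Omega_T(v)=\sum\omega_{Q_i}(v)$ over all $Q_i$ having $v$ as an endpoint. $(T,\sigma)$ is properly weighted if $\Omega_T(v)\le n$ for every joint $v$. -}

module Defs where

open import Data.Nat using (ℕ; zero; suc; _+_; _*_; _∸_; _≤_; _<_; _⊔_; NonZero; ≢-nonZero; ⌈_/2⌉)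
open import Data.Nat.DivMod using (_mod_; _/_)
open import Data.Nat.GCD using (gcd; gcd[m,n]≢0)
open import Data.Fin using (Fin; toℕ; _≟_)
open import Data.Bool using (Bool; true; false; if_then_else_; _∨_; T)
open import Data.Maybe using (Maybe; just; nothing)
open import Data.List using (List; []; _∷_; [_]; _++_; length; map; allFin; head; last)
open import Data.Bool.ListAction using (any)
open import Data.Nat.ListAction using (sum)
open import Data.List.Membership.Propositional using (_∈_)
open import Data.List.Relation.Unary.Unique.Propositional using (Unique)
open import Data.List.Relation.Unary.Linked using (Linked)
open import Data.Vec using (Vec; tabulate; lookup; toList)
import Data.Vec as Vec
open import Data.Product using (Σ; ∃; ∃-syntax; _×_; _,_)
open import Data.Sum using (_⊎_)
open import Data.Empty using (⊥)
open import Relation.Nullary using (¬_)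
open import Relation.Nullary.Decidable using (isYes)
open import Relation.Binary.PropositionalEquality using (_≡_; _≢_)

module Zn (n : ℕ) .{{_ : NonZero n}} where

  Z : Set
  Z = Fin n

  _+ₙ_ : Z → Z → Z
  a +ₙ b = (toℕ a + toℕ b) mod n

  -ₙ_ : Z → Z
  -ₙ a = (n ∸ toℕ a) mod n

  _-ₙ_ : Z → Z → Z
  a -ₙ b = a +ₙ (-ₙ b)

  _·ₙ_ : ℕ → Z → Z
  k ·ₙ a = (k * toℕ a) mod n

  0ₙ : Z
  0ₙ = 0 mod n

-- Simple graphs on Fin V (the non-loop part of a reflexive graph)

record SimpleGraph (V : ℕ) : Set₁ where
  field
    Adj    : Fin V → Fin V → Set
    sym    : ∀ {u v} → Adj u v → Adj v u
    irrefl : ∀ {u} → ¬ Adj u u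

data Walk {V : ℕ} (G : SimpleGraph V) : Fin V → Fin V → Set where
  here : ∀ {u} → Walk G u u
  step : ∀ {u w v} → SimpleGraph.Adj G u w → Walk G w v → Walk G u v

Connected : ∀ {V} → SimpleGraph V → Set
Connected G = ∀ u v → Walk G u v

CyclicallyLinked : ∀ {A : Set} → (A → A → Set) → List A → Set
CyclicallyLinked R []       = ⊥
CyclicallyLinked R (x ∷ xs) = Linked R ((x ∷ xs) ++ [ x ])

IsCycle : ∀ {V} → SimpleGraph V → List (Fin V) → Set
IsCycle G cs = 3 ≤ length cs × Unique cs × CyclicallyLinked (SimpleGraph.Adj G) cs

Acyclic : ∀ {V} → SimpleGraph V → Set
Acyclic G = ∀ cs → ¬ IsCycle G cs

-- a reflexive tree: its non-loop part is a tree (loops are encoded by the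
-- voltage assignment below, exactly one per vertex)
IsTree : ∀ {V} → SimpleGraph V → Set
IsTree G = Connected G × Acyclic G

record Voltage (V n : ℕ) .{{_ : NonZero n}} (G : SimpleGraph V) : Set where
  open Zn n
  field
    σE   : Fin V → Fin V → Z
    σL   : Fin V → Z                -- σ(v) on the primary loop at v
    anti : ∀ {u v} → SimpleGraph.Adj G u v → σE v u ≡ -ₙ (σE u v)
  -- the secondary loop at v carries -ₙ σL v

module _ {V n : ℕ} .{{_ : NonZero n}} {G : SimpleGraph V} (σ : Voltage V n G) where
  open Zn n
  open Voltage σ

  LiftAdj : Fin V × Z → Fin V × Z → Set
  LiftAdj (u , a) (v , b) =
      (SimpleGraph.Adj G u v × b ≡ a +ₙ σE u v)
    ⊎ (u ≡ v × (b ≡ a +ₙ σL u ⊎ b ≡ a +ₙ (-ₙ σL u)))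

  LiftHamiltonian : Set
  LiftHamiltonian = ∃[ cyc ] (3 ≤ length cyc × Unique cyc
                             × (∀ x → x ∈ cyc) × CyclicallyLinked LiftAdj cyc)

-- Reflexive paths given by a vertex list v₁ … vₘ, the extended billiard
-- strategy, c(Γ) and odd shifting paths

initL : ∀ {A : Set} → List A → List A
initL []           = []
initL (x ∷ [])     = []
initL (x ∷ y ∷ ys) = x ∷ initL (y ∷ ys)

interior : ∀ {A : Set} → List A → List A
interior []       = []
interior (x ∷ xs) = initL xs

maxL : List ℕ → ℕ
maxL []       = 0
maxL (x ∷ xs) = x ⊔ maxL xs

-- least s ∈ {start, start+1, …} with p s, searched with the given fuel
-- (with fuel n the search always succeeds in the uses below)
leastFrom : (ℕ → Bool) → ℕ → ℕ → ℕ
leastFrom p s zero     = s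
leastFrom p s (suc f)  = if p s then s else leastFrom p (suc s) f

module _ {V n : ℕ} .{{_ : NonZero n}} {G : SimpleGraph V} (σ : Voltage V n G) where
  open Zn n
  open Voltage σ

  cval : List (Fin V) → ℕ
  cval vs with interior vs
  ... | []    = 1
  ... | i ∷ is = ⌈ maxL (map (λ v → gcd n (toℕ (σL v))) (i ∷ is)) /2⌉

  memB : ∀ {d} → Z → Vec Z d → Bool
  memB z X = any (λ y → isYes (y ≟ z)) (toList X)

  slide : ∀ {d} → Vec Z d → Z → Z → Z
  slide X a x = x +ₙ (leastFrom (λ s → memB (x +ₙ (suc s ·ₙ a)) X) 0 n ·ₙ a)

  -- stages t ≥ 2 (the list starts at v_t)
  billiardFrom : ∀ {d} → Vec Z d → List (Fin V) → Vec Z d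
  billiardFrom xs (v ∷ w ∷ rest) =
    billiardFrom (Vec.map (λ x → slide xs (σL v) x +ₙ σE v w) xs) (w ∷ rest)
  billiardFrom xs _ = xs

  -- the whole strategy; returns the values x_j at which P_j arrives in v_m^σ
  billiard : ∀ {d} → Vec Z d → List (Fin V) → Vec Z d
  billiard xs (v ∷ w ∷ rest) = billiardFrom (Vec.map (λ x → x +ₙ σE v w) xs) (w ∷ rest)
  billiard xs _ = xs

  edgeSum : List (Fin V) → Z
  edgeSum (v ∷ w ∷ rest) = σE v w +ₙ edgeSum (w ∷ rest)
  edgeSum _ = 0ₙ

  loopSum : List (Fin V) → Z
  loopSum []       = 0ₙ
  loopSum (v ∷ vs) = σL v +ₙ loopSum vs

  -- β with l = 0
  beta : List (Fin V) → Z
  beta vs = (0ₙ +ₙ edgeSum vs) -ₙ loopSum (interior vs)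

  aIndex : ℕ → ℕ → ℕ → ℕ
  aIndex d s k = if isYes (Data.Nat._<?_ k s) then (d ∸ s) + k else k ∸ s

  gcdNZ : (r : Z) → NonZero (gcd (toℕ r) n)
  gcdNZ r = ≢-nonZero (gcd[m,n]≢0 (toℕ r) n (Data.Sum.inj₂ (Data.Nat.≢-nonZero⁻¹ n)))

  OddShifting : List (Fin V) → Z → Set
  OddShifting vs r =
    2 ≤ length vs ×
    Data.Maybe.map σL (head vs) ≡ just r ×
    Data.Maybe.map σL (last vs) ≡ just r ×
    (2 * cval vs ≤ (n / gcd (toℕ r) n) {{gcdNZ r}}) ×
    (∃[ s ] ((∃[ t ] s ≡ suc (2 * t)) × 0 < s × s < 2 * cval vs ×
       (∀ (k j : Fin (2 * cval vs)) → toℕ j ≡ aIndex (2 * cval vs) s (toℕ k) →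
          lookup (billiard (tabulate (λ (i : Fin (2 * cval vs)) → 0ₙ +ₙ (toℕ i ·ₙ r))) vs) j
            ≡ beta vs +ₙ (toℕ k ·ₙ r))))

ConsecIn : ∀ {A : Set} → List A → A → A → Set
ConsecIn (x ∷ y ∷ r) u v = (x ≡ u × y ≡ v) ⊎ ConsecIn (y ∷ r) u v
ConsecIn _ u v = ⊥

EdgeIn : ∀ {A : Set} → List A → A → A → Set
EdgeIn Q u v = ConsecIn Q u v ⊎ ConsecIn Q v u

IsPathIn : ∀ {V} → SimpleGraph V → List (Fin V) → Set
IsPathIn G vs = Unique vs × Linked (SimpleGraph.Adj G) vs

eqMaybe : ∀ {V} → Maybe (Fin V) → Fin V → Bool
eqMaybe (just x) v = isYes (x ≟ v)
eqMaybe nothing  v = false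

isEndpoint : ∀ {V} → List (Fin V) → Fin V → Bool
isEndpoint Q v = eqMaybe (head Q) v ∨ eqMaybe (last Q) v

module _ {V n : ℕ} .{{_ : NonZero n}} {G : SimpleGraph V} (σ : Voltage V n G) where
  open Zn n

  OddShiftingDecomposition : (k : ℕ) → (Fin k → List (Fin V)) → Z → Set
  OddShiftingDecomposition k Q r =
    (∀ i → IsPathIn G (Q i) × OddShifting σ (Q i) r) ×
    (∀ u v → SimpleGraph.Adj G u v → ∃[ i ] EdgeIn (Q i) u v) ×
    (∀ u v i j → EdgeIn (Q i) u v → EdgeIn (Q j) u v → i ≡ j) ×
    (∀ i j → i ≢ j → ∀ v → v ∈ Q i → v ∈ Q j →
       T (isEndpoint (Q i) v) × T (isEndpoint (Q j) v))

  Joint : (k : ℕ) → (Fin k → List (Fin V)) → Fin V → Set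
  Joint k Q v = ∃[ i ] T (isEndpoint (Q i) v)

  Ω : (k : ℕ) → (Fin k → List (Fin V)) → Fin V → ℕ
  Ω k Q v = sum (map (λ i → if isEndpoint (Q i) v then 2 * cval σ (Q i) else 0) (allFin k))

  ProperlyWeighted : (k : ℕ) → (Fin k → List (Fin V)) → Set
  ProperlyWeighted k Q = ∀ v → Joint k Q v → Ω k Q v ≤ n

{-# OPTIONS --safe #-}
-- Measured in steps of r, the fibre of a joint is an n-cycle.  An odd shifting path Q with d = 2c(Q) yields d disjoint
-- bridges which exactly cover the inner fibres and join the j-th vertex of an interval in the fibre of one end to the
-- (j + s mod d)-th vertex of an interval in the fibre of the other end: every stage of the billiard moves an arithmetic
-- progression of step r to a translate of itself, and d ≥ gcd(n, a) such values meet all cosets of ⟨a⟩.  Since s is odd,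
-- two cycles containing these intervals as subpaths merge with the bridges into a single cycle, which still contains
-- everything outside the two intervals as subpaths.  Proper weighting reserves disjoint intervals in each joint fibre,
-- so the paths can be merged one at a time, starting from one joint fibre and following the connected tree; acyclicity
-- guarantees that the far end of each new path lies in a fresh fibre.
module Submission where

open import Defs
open import Algebra.Bundles using (AbelianGroup)
import Algebra.Properties.AbelianGroup as AGP
import Algebra.Solver.CommutativeMonoid as CMS
open import Data.Bool using (Bool; true; false; if_then_else_; T)
open import Data.Bool.ListAction using (any)
open import Data.Bool.Properties using (T-∨)
open import Data.Empty using (⊥; ⊥-elim)
open import Data.Fin using (Fin; toℕ; fromℕ<; _≟_)
open import Data.Fin.Properties using (any?; toℕ-injective; toℕ-fromℕ<; toℕ<n)
import Data.List
open import Data.List using (List; []; _∷_; [_]; _++_; length; map; reverse; concat; concatMap; filter; applyUpTo; allFin; last)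
import Data.List.Membership.DecPropositional as DecMembership
open import Data.List.Membership.Propositional using (_∈_; _∉_; find; lose)
open import Data.List.Membership.Propositional.Properties using (∈-map⁺; ∈-map⁻; ∈-allFin; ∈-concatMap⁺; ∈-concatMap⁻; ∈-applyUpTo⁺; ∈-applyUpTo⁻; ∈-++⁺ˡ; ∈-++⁺ʳ; ∈-++⁻; ∈-∃++; ∈-filter⁺)
open import Data.List.Membership.Propositional.Properties.WithK using (unique∧set⇒bag)
open import Data.List.Properties using (++-assoc; ++-identityʳ; unfold-reverse; concat-++; concat-map; concatMap-++; concatMap-map; filter-notAll; length-++; length-map; length-tabulate; map-++; map-applyUpTo)
open import Data.List.Relation.Binary.BagAndSetEquality using (∼bag⇒↭)
import Data.List.Relation.Binary.Permutation.Propositional as Perm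
import Data.List.Relation.Binary.Permutation.Propositional.Properties as Perm
open import Data.List.Relation.Binary.Permutation.Propositional using (_↭_; prep; ↭-refl; ↭-sym; ↭-trans; ↭-reflexive; module PermutationReasoning)
open import Data.List.Relation.Binary.Permutation.Propositional.Properties using (++-commutativeMonoid; ++⁺; ++⁺ˡ; ++⁺ʳ; ↭-reverse; ∈-resp-↭; ↭-length)
import Data.List.Relation.Binary.Permutation.Setoid.Properties as SetoidPerm
open import Data.List.Relation.Unary.All as All using ([]; _∷_)
open import Data.List.Relation.Unary.All.Properties using (¬Any⇒All¬)
open import Data.List.Relation.Unary.AllPairs using ([]; _∷_)
open import Data.List.Relation.Unary.Any using (here; there)
open import Data.List.Relation.Unary.Any.Properties using (any⁺; any⁻)
open import Data.List.Relation.Unary.Linked using (Linked; []; [-]; _∷_)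
open import Data.List.Relation.Unary.Unique.Propositional using (Unique)
import Data.List.Relation.Unary.Unique.Propositional.Properties as Unique
open import Data.Maybe as Maybe using (just)
open import Data.Maybe.Properties using (just-injective)
open import Data.Nat using (ℕ; zero; suc; _+_; _*_; _∸_; _≤_; _<_; _<?_; z≤n; s≤s; NonZero; ≢-nonZero; ≢-nonZero⁻¹; ⌊_/2⌋; ⌈_/2⌉)
open import Data.Nat.Coprimality using (Coprime; coprime⇒gcd≡1)
open import Data.Nat.DivMod using (_mod_; _/_; _%_; m%n%n≡m%n; m%n<n; m<n⇒m%n≡m; m*n%n≡0; %-distribˡ-+; %-distribˡ-*; m≡m%n+[m/n]*n; m/n≤m)
open import Data.Nat.GCD using (gcd; gcd[m,n]≢0; gcd-GCD; gcd-comm; module Bézout)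
open import Data.Nat.ListAction using (sum)
open import Data.Nat.Properties hiding (_≟_)
open import Data.Nat.Solver using (module +-*-Solver)
open import Data.Product using (∃-syntax; _×_; _,_; proj₁; proj₂)
open import Data.Sum as Sum using (_⊎_; inj₁; inj₂; [_,_]′)
open import Data.Vec using (Vec; toList; lookup; tabulate)
import Data.Vec as Vec
import Data.Vec.Properties as Vec
open import Function using (_∘_; id; mk⇔; Equivalence)
open import Level using (0ℓ)
open import Relation.Binary.Construct.Closure.ReflexiveTransitive as Star using (Star; ε; _◅_; _◅◅_)
open import Relation.Binary.Definitions using (tri<; tri≈; tri>)
open import Relation.Binary.PropositionalEquality hiding ([_])
open import Relation.Nullary using (¬_; ¬?; Dec; yes; no)
open import Relation.Nullary.Decidable using (isYes; toWitness; fromWitness; decidable-stable)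

-- Three obstacles shape the construction. The stages of the billiard permute the paths in a way
-- that is hard to follow, so each stage is tracked only through the set of values it reaches; the
-- order of the paths is never computed and enters once, through the hypothesis on the final
-- arrivals. Next, a merge must not spoil the later ones: the zigzag over the bridges is arranged so
-- that what remains of either cycle is run through contiguously and in its original direction,
-- hence every other reserved interval is still traversed in steps of +r. Finally, the place of the
-- interval at one end forces its place at the other end, by the translation β.

applyUpTo-+ : ∀ {A : Set} (f : ℕ → A) m n → applyUpTo f (m + n) ≡ applyUpTo f m ++ applyUpTo (f ∘ (m +_)) n
applyUpTo-+ f zero    n = refl
applyUpTo-+ f (suc m) n = cong (f 0 ∷_) (applyUpTo-+ (f ∘ suc) m n)

applyUpTo-cong : ∀ {A : Set} {f g : ℕ → A} n → (∀ i → i < n → f i ≡ g i) → applyUpTo f n ≡ applyUpTo g n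
applyUpTo-cong zero    eq = refl
applyUpTo-cong (suc n) eq = cong₂ _∷_ (eq 0 (s≤s z≤n)) (applyUpTo-cong n (λ i lt → eq (suc i) (s≤s lt)))

-- Paths and cycles of a relation

module _ {A : Set} (R : A → A → Set) where

  -- The endpoints stay outside the list: bridges then list exactly their inner vertices, and a
  -- cycle is a path from its head back to its head.
  Path : A → List A → A → Set
  Path x []       y = R x y
  Path x (w ∷ ws) y = R x w × Path w ws y

  Cyc : List A → Set
  Cyc []       = ⊥
  Cyc (x ∷ xs) = Path x xs x

module _ {A : Set} {R : A → A → Set} where

  path-++ : ∀ {x y z} xs {ys} → Path R x xs y → Path R y ys z → Path R x (xs ++ y ∷ ys) z
  path-++ []       p       q = p , q
  path-++ (w ∷ ws) (r , p) q = r , path-++ ws p q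

  path-split : ∀ {x y z} xs {ys} → Path R x (xs ++ y ∷ ys) z → Path R x xs y × Path R y ys z
  path-split []       (p , q) = p , q
  path-split (w ∷ ws) (r , p) = let p₁ , p₂ = path-split ws p in (r , p₁) , p₂

  path-reverse : (∀ {x y} → R x y → R y x) → ∀ {x y} xs → Path R x xs y → Path R y (reverse xs) x
  path-reverse sy []       p = sy p
  path-reverse sy {x} {y} (w ∷ ws) (r , p) =
    subst (λ l → Path R y l x) (sym (unfold-reverse w ws)) (path-++ (reverse ws) (path-reverse sy ws p) (sy r))

  path⇒linked : ∀ {x y} xs → Path R x xs y → Linked R (x ∷ xs ++ [ y ])
  path⇒linked []       p       = p ∷ [-]
  path⇒linked (w ∷ ws) (r , p) = r ∷ path⇒linked ws p

  cyc⇒cyclicallyLinked : ∀ xs → Cyc R xs → CyclicallyLinked R xs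
  cyc⇒cyclicallyLinked (x ∷ xs) p = path⇒linked xs p

  cyc-rotate : ∀ xs ys → Cyc R (xs ++ ys) → Cyc R (ys ++ xs)
  cyc-rotate []       ys       c = subst (Cyc R) (sym (++-identityʳ ys)) c
  cyc-rotate (x ∷ xs) []       c = subst (Cyc R) (++-identityʳ (x ∷ xs)) c
  cyc-rotate (x ∷ xs) (y ∷ ys) c = let p , q = path-split xs c in path-++ ys q p

  path-applyUpTo : ∀ {y} (f : ℕ → A) m → (∀ j → R (f j) (f (suc j))) → ∀ {ys} →
    Path R (f m) ys y → Path R (f 0) (applyUpTo (f ∘ suc) m ++ ys) y
  path-applyUpTo f zero    link p = p
  path-applyUpTo f (suc m) link p = link 0 , path-applyUpTo (f ∘ suc) m (link ∘ suc) p

  path-drop : ∀ {y} (f : ℕ → A) m {ys} → Path R (f 0) (applyUpTo (f ∘ suc) m ++ ys) y → Path R (f m) ys y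
  path-drop f zero    p       = p
  path-drop f (suc m) (_ , p) = path-drop (f ∘ suc) m p

-- Merging two cycles along bridges

double : ℕ → ℕ
double zero    = zero
double (suc m) = suc (suc (double m))

module Weave {A : Set} where

  -- A zigzag that stands at `x 0`, not listed, and crosses two bridges per round, there and back.
  -- It therefore ends at `x (2m)`, on the side where it began, and `rest` continues from that
  -- vertex. Leaving out the start lets two weaves with the roles of the sides exchanged be glued
  -- together.
  weave : (x z : ℕ → A) (P : ℕ → List A) → ℕ → List A → List A
  weave x z P zero    rest = rest
  weave x z P (suc m) rest =
    x 1 ∷ P 1 ++ z 1 ∷ z 2 ∷ reverse (P 2) ++ x 2 ∷ weave (x ∘ (2 +_)) (z ∘ (2 +_)) (P ∘ (2 +_)) m rest

  weave-path : {R : A → A → Set} → (∀ {x y} → R x y → R y x) → ∀ x z P m {rest y} →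
    (∀ j → R (x j) (x (suc j))) → (∀ j → R (z j) (z (suc j))) →
    (∀ i → i < double m → Path R (x (suc i)) (P (suc i)) (z (suc i))) →
    Path R (x (double m)) rest y → Path R (x 0) (weave x z P m rest) y
  weave-path sy x z P zero    lx lz br p = p
  weave-path sy x z P (suc m) lx lz br p =
    lx 0 , path-++ (P 1) (br 0 (s≤s z≤n))
      (lz 1 , path-++ (reverse (P 2)) (path-reverse sy (P 2) (br 1 (s≤s (s≤s z≤n))))
        (weave-path sy (x ∘ (2 +_)) (z ∘ (2 +_)) (P ∘ (2 +_)) m (lx ∘ (2 +_)) (lz ∘ (2 +_))
          (λ i lt → br (2 + i) (s≤s (s≤s lt))) p))

  open CMS (++-commutativeMonoid {A = A}) using (solve; _⊕_; _⊜_)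

  weave-↭ : ∀ x z P m rest → weave x z P m rest ↭
    applyUpTo (x ∘ suc) (double m) ++ applyUpTo (z ∘ suc) (double m) ++ concat (applyUpTo (P ∘ suc) (double m)) ++ rest
  weave-↭ x z P zero    rest = ↭-refl
  weave-↭ x z P (suc m) rest = begin
    x 1 ∷ P 1 ++ z 1 ∷ z 2 ∷ reverse (P 2) ++ x 2 ∷ W
      ↭⟨ prep (x 1) (++⁺ˡ (P 1) (prep (z 1) (prep (z 2) (++⁺ (↭-reverse (P 2)) (prep (x 2) (weave-↭ (x ∘ (2 +_)) (z ∘ (2 +_)) (P ∘ (2 +_)) m rest)))))) ⟩
    [ x 1 ] ++ P 1 ++ [ z 1 ] ++ [ z 2 ] ++ P 2 ++ [ x 2 ] ++ X ++ Z ++ B ++ rest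
      ↭⟨ solve 10 (λ x1 p1 z1 z2 p2 x2 X Z B r →
           (x1 ⊕ (p1 ⊕ (z1 ⊕ (z2 ⊕ (p2 ⊕ (x2 ⊕ (X ⊕ (Z ⊕ (B ⊕ r)))))))))
           ⊜ ((x1 ⊕ (x2 ⊕ X)) ⊕ ((z1 ⊕ (z2 ⊕ Z)) ⊕ ((p1 ⊕ (p2 ⊕ B)) ⊕ r))))
           ↭-refl [ x 1 ] (P 1) [ z 1 ] [ z 2 ] (P 2) [ x 2 ] X Z B rest ⟩
    (x 1 ∷ x 2 ∷ X) ++ (z 1 ∷ z 2 ∷ Z) ++ (P 1 ++ P 2 ++ B) ++ rest ∎
    where
    open PermutationReasoning
    W X Z B : List A
    W = weave (x ∘ (2 +_)) (z ∘ (2 +_)) (P ∘ (2 +_)) m rest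
    X = applyUpTo (x ∘ (3 +_)) (double m)
    Z = applyUpTo (z ∘ (3 +_)) (double m)
    B = concat (applyUpTo (P ∘ (3 +_)) (double m))

  weave-++ : ∀ x z P m rest → weave x z P m rest ≡ weave x z P m [] ++ rest
  weave-++ x z P zero    rest = refl
  weave-++ x z P (suc m) rest = cong (x 1 ∷_) (trans
    (cong (λ l → P 1 ++ z 1 ∷ z 2 ∷ l)
      (trans (cong (λ l → reverse (P 2) ++ x 2 ∷ l) (weave-++ (x ∘ (2 +_)) (z ∘ (2 +_)) (P ∘ (2 +_)) m rest))
             (sym (++-assoc (reverse (P 2)) (x 2 ∷ W) rest))))
    (sym (++-assoc (P 1) (z 1 ∷ z 2 ∷ reverse (P 2) ++ x 2 ∷ W) rest)))
    where
    W : List A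
    W = weave (x ∘ (2 +_)) (z ∘ (2 +_)) (P ∘ (2 +_)) m []

  concat-reverse-↭ : ∀ (P : ℕ → List A) m → concat (applyUpTo (reverse ∘ P) m) ↭ concat (applyUpTo P m)
  concat-reverse-↭ P zero    = ↭-refl
  concat-reverse-↭ P (suc m) = ++⁺ (↭-reverse (P 0)) (concat-reverse-↭ (P ∘ suc) m)

  -- The bridges join x j to z (j + s mod d), where d = 2(e + t + 1) and s = 2t + 1.  Deleting the edges
  -- x (2i) – x (2i + 1) and z (2i) – z (2i + 1) from the two cycles leaves two matchings of the bridges; as s is odd,
  -- these are the two perfect matchings of a d-cycle, so the bridges are traversed in the order 0, 1, …, d − 1.
  module _ (x z : ℕ → A) (P : ℕ → List A) (e t : ℕ) (R₁ R₂ : List A) where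

    private
      s o d : ℕ
      s = suc (double t)
      o = suc (double e)
      d = o + s
      P₁ P₂ : ℕ → List A
      P₁ = reverse ∘ P
      P₂ = P ∘ (o +_)
      x₂ z₁ : ℕ → A
      x₂ = x ∘ (o +_)
      z₁ = z ∘ (s +_)

    mergeHead mergeTail : List A
    mergeHead = x 0 ∷ P 0 ++ z₁ 0 ∷ weave z₁ x P₁ e []
    mergeTail = z 0 ∷ reverse (P o) ++ x o ∷ weave x₂ z P₂ t []

    private
      K : List A
      K = x 0 ∷ P 0 ++ z₁ 0 ∷ weave z₁ x P₁ e (R₂ ++ z 0 ∷ reverse (P o) ++ x o ∷ weave x₂ z P₂ t R₁)

      K-eq : K ≡ mergeHead ++ R₂ ++ mergeTail ++ R₁
      K-eq = cong (x 0 ∷_) (trans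
        (cong (λ l → P 0 ++ z₁ 0 ∷ l)
          (trans (weave-++ z₁ x P₁ e _)
                 (cong (λ l → weave z₁ x P₁ e [] ++ R₂ ++ z 0 ∷ l)
                    (trans (cong (λ l → reverse (P o) ++ x o ∷ l) (weave-++ x₂ z P₂ t R₁))
                           (sym (++-assoc (reverse (P o)) (x o ∷ weave x₂ z P₂ t []) R₁))))))
        (sym (++-assoc (P 0) (z₁ 0 ∷ weave z₁ x P₁ e []) (R₂ ++ mergeTail ++ R₁))))

    -- The target index j + s mod d wraps around at j = o = d - s, which is why the bridges come in
    -- two families. Of the given cycles only the arcs outside the two segments are assumed, since
    -- the edges inside come from the first two hypotheses on `x` and `z`.
    merge-cyc : {R : A → A → Set} → (∀ {x y} → R x y → R y x) →
      (∀ j → R (x j) (x (suc j))) → (∀ j → R (z j) (z (suc j))) →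
      (∀ j → j < o → Path R (x j) (P j) (z (s + j))) →
      (∀ k → k < s → Path R (x (o + k)) (P (o + k)) (z k)) →
      Path R (x (o + double t)) R₁ (x 0) → Path R (z (s + double e)) R₂ (z 0) →
      Cyc R (mergeHead ++ R₂ ++ mergeTail ++ R₁)
    merge-cyc {R} R-sym lx lz br₁ br₂ c₁ c₂ = subst (Cyc R) K-eq
      (path-++ (P 0) (br₁ 0 (s≤s z≤n))
        (weave-path R-sym z₁ x P₁ e
          (λ j → subst (λ i → R (z (s + j)) (z i)) (sym (+-suc s j)) (lz (s + j))) lx
          (λ i lt → path-reverse R-sym (P (suc i)) (br₁ (suc i) (s≤s lt)))
          (path-++ R₂ c₂
            (path-++ (reverse (P o)) (path-reverse R-sym (P o) br-o)
              (subst (λ i → Path R (x i) (weave x₂ z P₂ t R₁) (x 0)) (+-identityʳ o) (weave-path R-sym x₂ z P₂ t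
                (λ j → subst (λ i → R (x (o + j)) (x i)) (sym (+-suc o j)) (lx (o + j))) lz
                (λ i lt → br₂ (suc i) (s≤s lt)) c₁))))))
      where
      br-o : Path R (x o) (P o) (z 0)
      br-o = subst (λ i → Path R (x i) (P i) (z 0)) (+-identityʳ o) (br₂ 0 (s≤s z≤n))

    merge-↭ : mergeHead ++ R₂ ++ mergeTail ++ R₁ ↭
      (applyUpTo x d ++ R₁) ++ (applyUpTo z d ++ R₂) ++ concat (applyUpTo P d)
    merge-↭ = begin
      mergeHead ++ R₂ ++ mergeTail ++ R₁ ≡⟨ K-eq ⟨
      K ↭⟨ prep (x 0) (++⁺ˡ (P 0) (prep (z₁ 0) (weave-↭ z₁ x P₁ e _))) ⟩
      [ x 0 ] ++ P 0 ++ [ z₁ 0 ] ++ Z₁ ++ X₁ ++ concat (applyUpTo (P₁ ∘ suc) (double e)) ++ R₂ ++ [ z 0 ] ++ reverse (P o) ++ [ x o ] ++ weave x₂ z P₂ t R₁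
        ↭⟨ prep (x 0) (++⁺ˡ (P 0) (prep (z₁ 0) (++⁺ˡ Z₁ (++⁺ˡ X₁ (++⁺ (concat-reverse-↭ (P ∘ suc) (double e))
             (++⁺ˡ R₂ (prep (z 0) (++⁺ (↭-reverse (P o)) (prep (x o) (weave-↭ x₂ z P₂ t R₁)))))))))) ⟩
      [ x 0 ] ++ P 0 ++ [ z₁ 0 ] ++ Z₁ ++ X₁ ++ B₁ ++ R₂ ++ [ z 0 ] ++ P o ++ [ x o ] ++ X₂ ++ Z₂ ++ B₂ ++ R₁
        ↭⟨ solve 14 (λ x0 p0 z1 Z1 X1 B1 r2 z0 po xo X2 Z2 B2 r1 →
             (x0 ⊕ (p0 ⊕ (z1 ⊕ (Z1 ⊕ (X1 ⊕ (B1 ⊕ (r2 ⊕ (z0 ⊕ (po ⊕ (xo ⊕ (X2 ⊕ (Z2 ⊕ (B2 ⊕ r1)))))))))))))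
             ⊜ ((((x0 ⊕ X1) ⊕ (xo ⊕ X2)) ⊕ r1) ⊕ ((((z0 ⊕ Z2) ⊕ (z1 ⊕ Z1)) ⊕ r2) ⊕ ((p0 ⊕ B1) ⊕ (po ⊕ B2)))))
             ↭-refl [ x 0 ] (P 0) [ z₁ 0 ] Z₁ X₁ B₁ R₂ [ z 0 ] (P o) [ x o ] X₂ Z₂ B₂ R₁ ⟩
      ((([ x 0 ] ++ X₁) ++ ([ x o ] ++ X₂)) ++ R₁) ++ ((([ z 0 ] ++ Z₂) ++ ([ z₁ 0 ] ++ Z₁)) ++ R₂) ++ ((P 0 ++ B₁) ++ (P o ++ B₂))
        ≡⟨ cong₂ _++_ (cong (_++ R₁) (sym xs-eq)) (cong₂ _++_ (cong (_++ R₂) (sym zs-eq)) (sym ps-eq)) ⟩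
      (applyUpTo x d ++ R₁) ++ (applyUpTo z d ++ R₂) ++ concat (applyUpTo P d) ∎
      where
      open PermutationReasoning
      X₁ X₂ Z₁ Z₂ B₁ B₂ : List A
      X₁ = applyUpTo (x ∘ suc) (double e)
      X₂ = applyUpTo (x₂ ∘ suc) (double t)
      Z₁ = applyUpTo (z₁ ∘ suc) (double e)
      Z₂ = applyUpTo (z ∘ suc) (double t)
      B₁ = concat (applyUpTo (P ∘ suc) (double e))
      B₂ = concat (applyUpTo (P₂ ∘ suc) (double t))
      xs-eq : applyUpTo x d ≡ ([ x 0 ] ++ X₁) ++ ([ x o ] ++ X₂)
      xs-eq = trans (applyUpTo-+ x o s) (cong (λ i → ([ x 0 ] ++ X₁) ++ x i ∷ X₂) (+-identityʳ o))
      zs-eq : applyUpTo z d ≡ ([ z 0 ] ++ Z₂) ++ ([ z₁ 0 ] ++ Z₁)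
      zs-eq = trans (cong (applyUpTo z) (+-comm o s)) (applyUpTo-+ z s o)
      ps-eq : concat (applyUpTo P d) ≡ (P 0 ++ B₁) ++ (P o ++ B₂)
      ps-eq = trans (cong concat (applyUpTo-+ P o s)) (trans (sym (concat-++ (applyUpTo P o) (applyUpTo P₂ s)))
        (cong (λ i → (P 0 ++ B₁) ++ P i ++ B₂) (+-identityʳ o)))

-- Arithmetic of the cyclic group

module ZnArithmetic (n : ℕ) .{{_ : NonZero n}} where
  open Zn n public
  open ≡-Reasoning

  1+[n∸1]≡n : suc (n ∸ 1) ≡ n
  1+[n∸1]≡n = m+[n∸m]≡n (n≢0⇒n>0 (≢-nonZero⁻¹ n))

  ι : ℕ → Z
  ι m = m mod n

  toℕ-ι : ∀ m → toℕ (ι m) ≡ m % n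
  toℕ-ι m = toℕ-fromℕ< (m%n<n m n)

  ι-cong : ∀ {m m′} → m % n ≡ m′ % n → ι m ≡ ι m′
  ι-cong {m} {m′} eq = toℕ-injective (trans (toℕ-ι m) (trans eq (sym (toℕ-ι m′))))

  ι-toℕ : ∀ a → ι (toℕ a) ≡ a
  ι-toℕ a = toℕ-injective (trans (toℕ-ι (toℕ a)) (m<n⇒m%n≡m (toℕ<n a)))

  ι-injective : ∀ {j k} → j < n → k < n → ι j ≡ ι k → j ≡ k
  ι-injective {j} {k} j<n k<n eq = begin
    j         ≡⟨ m<n⇒m%n≡m j<n ⟨
    j % n     ≡⟨ toℕ-ι j ⟨
    toℕ (ι j) ≡⟨ cong toℕ eq ⟩
    toℕ (ι k) ≡⟨ toℕ-ι k ⟩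
    k % n     ≡⟨ m<n⇒m%n≡m k<n ⟩
    k         ∎

  ι-+ : ∀ a b → ι a +ₙ ι b ≡ ι (a + b)
  ι-+ a b = ι-cong (trans (cong (_% n) (cong₂ _+_ (toℕ-ι a) (toℕ-ι b))) (sym (%-distribˡ-+ a b n)))

  ·ₙ-ι : ∀ k m → k ·ₙ ι m ≡ ι (k * m)
  ·ₙ-ι k m = ι-cong (begin
    (k * toℕ (ι m)) % n           ≡⟨ %-distribˡ-* k (toℕ (ι m)) n ⟩
    ((k % n) * (toℕ (ι m) % n)) % n ≡⟨ cong (λ u → ((k % n) * u) % n) (trans (cong (_% n) (toℕ-ι m)) (m%n%n≡m%n m n)) ⟩
    ((k % n) * (m % n)) % n       ≡⟨ %-distribˡ-* k m n ⟨
    (k * m) % n                   ∎)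

  ι-*n : ∀ q → ι (q * n) ≡ 0ₙ
  ι-*n q = ι-cong (trans (m*n%n≡0 q n) (sym (m*n%n≡0 0 n)))

  +ₙ-comm : ∀ a b → a +ₙ b ≡ b +ₙ a
  +ₙ-comm a b = cong ι (+-comm (toℕ a) (toℕ b))

  +ₙ-assoc : ∀ a b c → (a +ₙ b) +ₙ c ≡ a +ₙ (b +ₙ c)
  +ₙ-assoc a b c = begin
    ι (toℕ a + toℕ b) +ₙ c                 ≡⟨ cong (ι (toℕ a + toℕ b) +ₙ_) (ι-toℕ c) ⟨
    ι (toℕ a + toℕ b) +ₙ ι (toℕ c)         ≡⟨ ι-+ _ (toℕ c) ⟩
    ι (toℕ a + toℕ b + toℕ c)              ≡⟨ cong ι (+-assoc (toℕ a) (toℕ b) (toℕ c)) ⟩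
    ι (toℕ a + (toℕ b + toℕ c))            ≡⟨ ι-+ (toℕ a) _ ⟨
    ι (toℕ a) +ₙ ι (toℕ b + toℕ c)         ≡⟨ cong (_+ₙ (b +ₙ c)) (ι-toℕ a) ⟩
    a +ₙ (b +ₙ c)                          ∎

  +ₙ-identityˡ : ∀ a → 0ₙ +ₙ a ≡ a
  +ₙ-identityˡ a = trans (cong (0ₙ +ₙ_) (sym (ι-toℕ a))) (trans (ι-+ 0 (toℕ a)) (ι-toℕ a))

  +ₙ-identityʳ : ∀ a → a +ₙ 0ₙ ≡ a
  +ₙ-identityʳ a = trans (+ₙ-comm a 0ₙ) (+ₙ-identityˡ a)

  +ₙ-inverseʳ : ∀ a → a +ₙ (-ₙ a) ≡ 0ₙ
  +ₙ-inverseʳ a = begin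
    a +ₙ ι (n ∸ toℕ a)         ≡⟨ cong (_+ₙ ι (n ∸ toℕ a)) (ι-toℕ a) ⟨
    ι (toℕ a) +ₙ ι (n ∸ toℕ a) ≡⟨ ι-+ (toℕ a) _ ⟩
    ι (toℕ a + (n ∸ toℕ a))    ≡⟨ cong ι (m+[n∸m]≡n (<⇒≤ (toℕ<n a))) ⟩
    ι n                        ≡⟨ cong ι (*-identityˡ n) ⟨
    ι (1 * n)                  ≡⟨ ι-*n 1 ⟩
    0ₙ                         ∎

  +ₙ-abelianGroup : AbelianGroup 0ℓ 0ℓ
  +ₙ-abelianGroup = record
    { Carrier = Z ; _≈_ = _≡_ ; _∙_ = _+ₙ_ ; ε = 0ₙ ; _⁻¹ = λ a → -ₙ a
    ; isAbelianGroup = record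
      { isGroup = record
        { isMonoid = record
          { isSemigroup = record
            { isMagma = record { isEquivalence = isEquivalence ; ∙-cong = cong₂ _+ₙ_ }
            ; assoc = +ₙ-assoc }
          ; identity = +ₙ-identityˡ , +ₙ-identityʳ }
        ; inverse = (λ a → trans (+ₙ-comm (-ₙ a) a) (+ₙ-inverseʳ a)) , +ₙ-inverseʳ
        ; ⁻¹-cong = cong (λ a → -ₙ a) }
      ; comm = +ₙ-comm } }

  open AGP +ₙ-abelianGroup public using () renaming
    (∙-cancelˡ to +ₙ-cancelˡ; ∙-cancelʳ to +ₙ-cancelʳ)

  -ₙ-cancelʳ : ∀ a b → (a -ₙ b) +ₙ b ≡ a
  -ₙ-cancelʳ a b = trans (+ₙ-assoc a (-ₙ b) b) (trans (cong (a +ₙ_) (trans (+ₙ-comm (-ₙ b) b) (+ₙ-inverseʳ b))) (+ₙ-identityʳ a))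

  +ₙ-cancel-ₙ : ∀ a b → (a +ₙ b) -ₙ b ≡ a
  +ₙ-cancel-ₙ a b = trans (+ₙ-assoc a b (-ₙ b)) (trans (cong (a +ₙ_) (+ₙ-inverseʳ b)) (+ₙ-identityʳ a))

  ·ₙ-distrib-+ : ∀ j k a → (j + k) ·ₙ a ≡ (j ·ₙ a) +ₙ (k ·ₙ a)
  ·ₙ-distrib-+ j k a = trans (cong ι (*-distribʳ-+ (toℕ a) j k)) (sym (ι-+ (j * toℕ a) (k * toℕ a)))

  1·ₙ : ∀ a → 1 ·ₙ a ≡ a
  1·ₙ a = trans (cong ι (*-identityˡ (toℕ a))) (ι-toℕ a)

  ·ₙ-assoc : ∀ j k a → (j * k) ·ₙ a ≡ j ·ₙ (k ·ₙ a)
  ·ₙ-assoc j k a = trans (cong ι (*-assoc j k (toℕ a))) (sym (·ₙ-ι j (k * toℕ a)))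

  [q*n]·ₙ : ∀ q a → (q * n) ·ₙ a ≡ 0ₙ
  [q*n]·ₙ q a = trans (cong ι (trans (*-assoc q n (toℕ a)) (trans (cong (q *_) (*-comm n (toℕ a))) (sym (*-assoc q (toℕ a) n))))) (ι-*n (q * toℕ a))

  n·ₙ : ∀ a → n ·ₙ a ≡ 0ₙ
  n·ₙ a = trans (cong (_·ₙ a) (sym (*-identityˡ n))) ([q*n]·ₙ 1 a)

  +ₙ-suc : ∀ b j a → (b +ₙ (j ·ₙ a)) +ₙ a ≡ b +ₙ (suc j ·ₙ a)
  +ₙ-suc b j a = trans (+ₙ-assoc b (j ·ₙ a) a) (cong (b +ₙ_) (begin
    (j ·ₙ a) +ₙ a        ≡⟨ cong ((j ·ₙ a) +ₙ_) (1·ₙ a) ⟨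
    (j ·ₙ a) +ₙ (1 ·ₙ a) ≡⟨ ·ₙ-distrib-+ j 1 a ⟨
    (j + 1) ·ₙ a         ≡⟨ cong (_·ₙ a) (+-comm j 1) ⟩
    suc j ·ₙ a           ∎))

  +ₙ-shift : ∀ b j k a → (b +ₙ (j ·ₙ a)) +ₙ (k ·ₙ a) ≡ b +ₙ ((j + k) ·ₙ a)
  +ₙ-shift b j k a = trans (+ₙ-assoc b (j ·ₙ a) (k ·ₙ a)) (cong (b +ₙ_) (sym (·ₙ-distrib-+ j k a)))

  bézout : ∀ a → ∃[ i ] i ·ₙ a ≡ ι (gcd n (toℕ a))
  bézout a with Bézout.identity (gcd-GCD n (toℕ a))
  ... | Bézout.-+ x y eq = y , trans (cong ι (sym eq)) (trans (sym (ι-+ _ (x * n))) (trans (cong (ι _ +ₙ_) (ι-*n x)) (+ₙ-identityʳ _)))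
  -- Here the identity reads gcd + y·a = x·n over the natural numbers, so the multiplier of `a`
  -- should be -y; it is represented by y(n - 1).
  ... | Bézout.+- x y eq = y * (n ∸ 1) , +ₙ-cancelʳ (y ·ₙ a) _ _ (begin
    ((y * (n ∸ 1)) ·ₙ a) +ₙ (y ·ₙ a) ≡⟨ ·ₙ-distrib-+ (y * (n ∸ 1)) y a ⟨
    (y * (n ∸ 1) + y) ·ₙ a           ≡⟨ cong (_·ₙ a) lemma ⟩
    (y * n) ·ₙ a                     ≡⟨ [q*n]·ₙ y a ⟩
    0ₙ                               ≡⟨ ι-*n x ⟨
    ι (x * n)                        ≡⟨ cong ι eq ⟨
    ι (gcd n (toℕ a) + y * toℕ a)    ≡⟨ ι-+ _ (y * toℕ a) ⟨
    ι (gcd n (toℕ a)) +ₙ (y ·ₙ a)    ∎)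
    where
    lemma : y * (n ∸ 1) + y ≡ y * n
    lemma = begin
      y * (n ∸ 1) + y     ≡⟨ cong (y * (n ∸ 1) +_) (*-identityʳ y) ⟨
      y * (n ∸ 1) + y * 1 ≡⟨ *-distribˡ-+ y (n ∸ 1) 1 ⟨
      y * (n ∸ 1 + 1)     ≡⟨ cong (y *_) (m∸n+n≡m (n≢0⇒n>0 (≢-nonZero⁻¹ n))) ⟩
      y * n               ∎

  module _ (r : Z) (coprime : Coprime (toℕ r) n) where

    coprime-inverse : ∃[ i ] i ·ₙ r ≡ ι 1
    coprime-inverse = let i , eq = bézout r in
      i , trans eq (cong ι (trans (gcd-comm n (toℕ r)) (coprime⇒gcd≡1 coprime)))

    ·ₙ-surjective : ∀ z → ∃[ u ] u ·ₙ r ≡ z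
    ·ₙ-surjective z = let i , eq = coprime-inverse in toℕ z * i , (begin
      (toℕ z * i) ·ₙ r ≡⟨ ·ₙ-assoc (toℕ z) i r ⟩
      toℕ z ·ₙ (i ·ₙ r) ≡⟨ cong (toℕ z ·ₙ_) eq ⟩
      toℕ z ·ₙ ι 1      ≡⟨ ·ₙ-ι (toℕ z) 1 ⟩
      ι (toℕ z * 1)     ≡⟨ cong ι (*-identityʳ (toℕ z)) ⟩
      ι (toℕ z)         ≡⟨ ι-toℕ z ⟩
      z                 ∎)

    ·ₙ-injective : ∀ {j k} → j < n → k < n → j ·ₙ r ≡ k ·ₙ r → j ≡ k
    ·ₙ-injective {j} {k} j<n k<n eq = ι-injective j<n k<n (trans (sym (back j)) (trans (cong (i ·ₙ_) eq) (back k)))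
      where
      i = proj₁ coprime-inverse
      back : ∀ j → i ·ₙ (j ·ₙ r) ≡ ι j
      back j = begin
        i ·ₙ (j ·ₙ r)  ≡⟨ ·ₙ-assoc i j r ⟨
        (i * j) ·ₙ r   ≡⟨ cong (_·ₙ r) (*-comm i j) ⟩
        (j * i) ·ₙ r   ≡⟨ ·ₙ-assoc j i r ⟩
        j ·ₙ (i ·ₙ r)  ≡⟨ cong (j ·ₙ_) (proj₂ coprime-inverse) ⟩
        j ·ₙ ι 1       ≡⟨ ·ₙ-ι j 1 ⟩
        ι (j * 1)      ≡⟨ cong ι (*-identityʳ j) ⟩
        ι j            ∎

    -- r generates ℤₙ modulo ⟨a⟩, a cyclic group of order gcd(n, a).
    coset-representative : ∀ {d} a → gcd n (toℕ a) ≤ d → ∀ z →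
      ∃[ k ] k < d × ∃[ i ] z ≡ (k ·ₙ r) +ₙ (i ·ₙ a)
    coset-representative {d} a g≤d z = u % g , <-≤-trans (m%n<n u g) g≤d , (u / g) * toℕ r * i , (begin
      z                                            ≡⟨ proj₂ (·ₙ-surjective z) ⟨
      u ·ₙ r                                       ≡⟨ cong (_·ₙ r) (m≡m%n+[m/n]*n u g) ⟩
      (u % g + (u / g) * g) ·ₙ r                   ≡⟨ ·ₙ-distrib-+ (u % g) _ r ⟩
      ((u % g) ·ₙ r) +ₙ (((u / g) * g) ·ₙ r)       ≡⟨ cong (((u % g) ·ₙ r) +ₙ_) (begin
        ((u / g) * g) ·ₙ r             ≡⟨ cong ι (solve 3 (λ q g r → q :* g :* r := q :* r :* g) refl (u / g) g (toℕ r)) ⟩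
        ι ((u / g) * toℕ r * g)        ≡⟨ ·ₙ-ι ((u / g) * toℕ r) g ⟨
        ((u / g) * toℕ r) ·ₙ ι g       ≡⟨ cong (((u / g) * toℕ r) ·ₙ_) (proj₂ (bézout a)) ⟨
        ((u / g) * toℕ r) ·ₙ (i ·ₙ a)  ≡⟨ ·ₙ-assoc ((u / g) * toℕ r) i a ⟨
        ((u / g) * toℕ r * i) ·ₙ a     ∎) ⟩
      ((u % g) ·ₙ r) +ₙ (((u / g) * toℕ r * i) ·ₙ a) ∎)
      where
      open +-*-Solver
      g u i : ℕ
      g = gcd n (toℕ a)
      u = proj₁ (·ₙ-surjective z)
      i = proj₁ (bézout a)
      instance
        g≢0 : NonZero g
        g≢0 = ≢-nonZero (gcd[m,n]≢0 n (toℕ a) (inj₁ (≢-nonZero⁻¹ n)))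

-- Bounded search and duplicate-free lists

leastFrom-spec : ∀ (p : ℕ → Bool) s f m → s ≤ m → m < s + f → T (p m) →
  T (p (leastFrom p s f)) × (∀ i → s ≤ i → i < leastFrom p s f → ¬ T (p i))
leastFrom-spec p s zero    m s≤m m<s+0 pm = ⊥-elim (<⇒≱ m<s+0 (subst (_≤ m) (sym (+-identityʳ s)) s≤m))
leastFrom-spec p s (suc f) m s≤m m<s+f pm with p s in eq
... | true  = subst T (sym eq) _ , λ i s≤i i<s _ → <⇒≱ i<s s≤i
... | false =
  let s<m = ≤∧≢⇒< s≤m (λ { refl → subst T eq pm })
      found , minimal = leastFrom-spec p (suc s) f m s<m (subst (m <_) (+-suc s f) m<s+f) pm
  in found , λ i s≤i i<l pi → minimal i (≤∧≢⇒< s≤i (λ { refl → subst T eq pi })) i<l pi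

unique-map : ∀ {A B : Set} (f : A → B) {xs} → (∀ {x y} → x ∈ xs → y ∈ xs → f x ≡ f y → x ≡ y) →
  Unique xs → Unique (map f xs)
unique-map f inj []          = []
unique-map f {x ∷ xs} inj (x∉ ∷ uniq) =
  All.tabulate (λ {fy} fy∈ fx≡fy → let y , y∈ , eq = ∈-map⁻ f fy∈ in
    All.lookup x∉ y∈ (inj (here refl) (there y∈) (trans fx≡fy eq)))
  ∷ unique-map f (λ p q → inj (there p) (there q)) uniq

unique-concatMap : ∀ {A B : Set} (f : A → List B) {xs} → (∀ {x} → x ∈ xs → Unique (f x)) →
  (∀ {x y b} → x ∈ xs → y ∈ xs → b ∈ f x → b ∈ f y → x ≡ y) → Unique xs → Unique (concatMap f xs)
unique-concatMap f uf inj [] = []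
unique-concatMap f {x ∷ xs} uf inj (x∉ ∷ uniq) = Unique.++⁺ (uf (here refl))
  (unique-concatMap f (uf ∘ there) (λ p q → inj (there p) (there q)) uniq)
  (λ (b∈fx , b∈rest) → let y , y∈ , b∈fy = find (∈-concatMap⁻ f b∈rest) in
    All.lookup x∉ y∈ (inj (here refl) (there y∈) b∈fx b∈fy))

unique-↭ : ∀ {A : Set} {xs ys : List A} → Unique xs → Unique ys →
  (∀ {x} → x ∈ xs → x ∈ ys) → (∀ {x} → x ∈ ys → x ∈ xs) → xs ↭ ys
unique-↭ ux uy to from = ∼bag⇒↭ (unique∧set⇒bag ux uy (mk⇔ to from))

concatMap-[] : ∀ {A B : Set} (xs : List A) → concatMap {B = B} (λ _ → []) xs ≡ []
concatMap-[] []       = refl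
concatMap-[] (x ∷ xs) = concatMap-[] xs

concatMap-++-↭ : ∀ {A B : Set} (f g : A → List B) xs → concatMap (λ x → f x ++ g x) xs ↭ concatMap f xs ++ concatMap g xs
concatMap-++-↭ f g []       = ↭-refl
concatMap-++-↭ {B = B} f g (x ∷ xs) = ↭-trans (++⁺ˡ (f x ++ g x) (concatMap-++-↭ f g xs))
  (solve 4 (λ a b c d → ((a ⊕ b) ⊕ (c ⊕ d)) ⊜ ((a ⊕ c) ⊕ (b ⊕ d))) ↭-refl (f x) (g x) (concatMap f xs) (concatMap g xs))
  where open CMS (++-commutativeMonoid {A = B}) using (solve; _⊕_; _⊜_)

endV : ∀ {A : Set} → A → List A → A
endV v []       = v
endV v (w ∷ ws) = endV w ws

-- The billiard strategy and the vertices it visits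

module Billiard {V n : ℕ} .{{_ : NonZero n}} {G : SimpleGraph V} (σ : Voltage V n G)
  (r : Fin n) (coprime : Coprime (toℕ r) n) where
  open ZnArithmetic n public
  open Voltage σ public
  open SimpleGraph G using (Adj) renaming (sym to Adj-sym) public

  Adjᴸ : Fin V × Z → Fin V × Z → Set
  Adjᴸ = LiftAdj σ

  Adjᴸ-sym : ∀ {x y} → Adjᴸ x y → Adjᴸ y x
  Adjᴸ-sym {u , a} {v , b} (inj₁ (uv , refl)) =
    inj₁ (Adj-sym uv , sym (trans (cong ((a +ₙ σE u v) +ₙ_) (anti uv)) (+ₙ-cancel-ₙ a (σE u v))))
  Adjᴸ-sym {u , a} (inj₂ (refl , inj₁ refl)) = inj₂ (refl , inj₂ (sym (+ₙ-cancel-ₙ a (σL u))))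
  Adjᴸ-sym {u , a} (inj₂ (refl , inj₂ refl)) = inj₂ (refl , inj₁ (sym (-ₙ-cancelʳ a (σL u))))

  pos : Fin V → Z → Z → ℕ → Fin V × Z
  pos v b a j = v , b +ₙ (j ·ₙ a)

  pos-step : ∀ v b {a} → σL v ≡ a → ∀ j → Adjᴸ (pos v b a j) (pos v b a (suc j))
  pos-step v b refl j = inj₂ (refl , inj₁ (sym (+ₙ-suc b j (σL v))))

  fib : Fin V → List (Fin V × Z)
  fib v = map (v ,_) (allFin n)

  fib-unique : ∀ v → Unique (fib v)
  fib-unique v = Unique.map⁺ (λ { refl → refl }) (Unique.allFin⁺ n)

  ∈-fib : ∀ v z → (v , z) ∈ fib v
  ∈-fib v z = ∈-map⁺ (v ,_) (∈-allFin z)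

  ∈-fib⁻ : ∀ {v x} → x ∈ fib v → proj₁ x ≡ v
  ∈-fib⁻ {v} x∈ with _ , _ , refl ← ∈-map⁻ (v ,_) x∈ = refl

  module _ (L : List Z) (a : Z) where

    private
      p : Z → ℕ → Bool
      p x s = any (λ y → isYes (y ≟ (x +ₙ (suc s ·ₙ a)))) L

      p⇒∈ : ∀ {x} s → T (p x s) → (x +ₙ (suc s ·ₙ a)) ∈ L
      p⇒∈ {x} s h = let y , y∈ , eq = find (any⁻ _ L h) in
        subst (_∈ L) (toWitness {a? = y ≟ (x +ₙ (suc s ·ₙ a))} eq) y∈

      ∈⇒p : ∀ {x} s → (x +ₙ (suc s ·ₙ a)) ∈ L → T (p x s)
      ∈⇒p {x} s h = any⁺ _ (lose h (fromWitness {a? = (x +ₙ (suc s ·ₙ a)) ≟ (x +ₙ (suc s ·ₙ a))} refl))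

    steps : Z → ℕ
    steps x = leastFrom (p x) 0 n

    slideL : Z → Z
    slideL x = x +ₙ (steps x ·ₙ a)

    private
      steps-spec : ∀ {x} → x ∈ L → T (p x (steps x)) × (∀ i → 0 ≤ i → i < steps x → ¬ T (p x i))
      -- Fuel `n` suffices: the candidate n - 1 stands for the full turn x + n·a = x, which lies in
      -- `L`.
      steps-spec {x} x∈ = leastFrom-spec (p x) 0 n (n ∸ 1) z≤n (≤-reflexive 1+[n∸1]≡n)
        (∈⇒p (n ∸ 1) (subst (_∈ L) (sym (trans (cong (λ k → x +ₙ (k ·ₙ a)) 1+[n∸1]≡n) (trans (cong (x +ₙ_) (n·ₙ a)) (+ₙ-identityʳ x)))) x∈))

    steps-hit : ∀ {x} → x ∈ L → (x +ₙ (suc (steps x) ·ₙ a)) ∈ L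
    steps-hit {x} x∈ = p⇒∈ (steps x) (proj₁ (steps-spec x∈))

    steps-minimal : ∀ {x} → x ∈ L → ∀ {i} → i < steps x → (x +ₙ (suc i ·ₙ a)) ∉ L
    steps-minimal x∈ {i} i< h = proj₂ (steps-spec x∈) i z≤n i< (∈⇒p i h)

    private
      -- Cancelling i steps puts x itself on the run of y, at a positive distance j - i ≤ `steps y`;
      -- but a run stops just before it meets `L`. The case x = y shows that a run does not meet
      -- itself.
      runs-apart : ∀ {x y i j} → x ∈ L → y ∈ L → j ≤ steps y → i < j → x +ₙ (i ·ₙ a) ≢ y +ₙ (j ·ₙ a)
      runs-apart {x} {y} {i} {j} x∈ y∈ j≤ i<j eq with k , refl ← m≤n⇒∃[o]m+o≡n i<j =
        steps-minimal y∈ {k} (<-≤-trans (m<n+m k (s≤s z≤n)) j≤)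
          (subst (_∈ L) (+ₙ-cancelʳ (i ·ₙ a) _ _ (trans eq (trans
            (cong (λ m → y +ₙ (m ·ₙ a)) (cong suc (+-comm i k))) (sym (+ₙ-shift y (suc k) i a))))) x∈)

    runs-meet : ∀ {x y i j} → x ∈ L → y ∈ L → i ≤ steps x → j ≤ steps y →
      x +ₙ (i ·ₙ a) ≡ y +ₙ (j ·ₙ a) → i ≡ j × x ≡ y
    runs-meet {x} {y} {i} {j} x∈ y∈ i≤ j≤ eq with <-cmp i j
    ... | tri< i<j _ _ = ⊥-elim (runs-apart x∈ y∈ j≤ i<j eq)
    ... | tri> _ _ j<i = ⊥-elim (runs-apart y∈ x∈ i≤ j<i (sym eq))
    ... | tri≈ _ refl _ = refl , +ₙ-cancelʳ (i ·ₙ a) x y eq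

    -- If i overshoots the run of x, the step right after that run hits another element of `L`, and
    -- the search restarts there with a strictly smaller distance.
    cover-from : ∀ fuel {x i} → i < fuel → x ∈ L → ∃[ y ] ∃[ j ] y ∈ L × j ≤ steps y × x +ₙ (i ·ₙ a) ≡ y +ₙ (j ·ₙ a)
    cover-from (suc fuel) {x} {i} (s≤s i≤) x∈ with i ≤? steps x
    ... | yes i≤s = x , i , x∈ , i≤s , refl
    ... | no  i≰s with k , refl ← m≤n⇒∃[o]m+o≡n (≰⇒> i≰s) =
      let y , j , y∈ , j≤ , eq = cover-from fuel {_} {k} (<-≤-trans (m<n+m k (s≤s z≤n)) i≤) (steps-hit x∈)
      in y , j , y∈ , j≤ , trans (sym (+ₙ-shift x (suc (steps x)) k a)) eq

    run : Fin V → Z → List (Fin V × Z)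
    run v x = applyUpTo (pos v x a) (suc (steps x))

    module _ (L-unique : Unique L) (cover : ∀ z → ∃[ x ] ∃[ i ] x ∈ L × z ≡ x +ₙ (i ·ₙ a)) where

      cover-run : ∀ z → ∃[ x ] ∃[ i ] x ∈ L × i ≤ steps x × z ≡ x +ₙ (i ·ₙ a)
      cover-run z = let x , i , x∈ , eq = cover z
                        y , j , y∈ , j≤ , eq′ = cover-from (suc i) ≤-refl x∈
                    in y , j , y∈ , j≤ , trans eq eq′

      runs-↭ : ∀ v → concatMap (run v) L ↭ fib v
      runs-↭ v = unique-↭ (unique-concatMap (run v) run-unique run-disjoint L-unique) (fib-unique v) to from
        where
        run-unique : ∀ {x} → x ∈ L → Unique (run v x)
        run-unique {x} x∈ = Unique.applyUpTo⁺₁ (pos v x a) (suc (steps x))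
          (λ i<j j<s eq → runs-apart x∈ x∈ (≤-pred j<s) i<j (cong proj₂ eq))
        run-disjoint : ∀ {x y b} → x ∈ L → y ∈ L → b ∈ run v x → b ∈ run v y → x ≡ y
        run-disjoint {x} {y} x∈ y∈ p q with i , i< , refl ← ∈-applyUpTo⁻ (pos v x a) p | j , j< , eq ← ∈-applyUpTo⁻ (pos v y a) q =
          proj₂ (runs-meet x∈ y∈ (≤-pred i<) (≤-pred j<) (cong proj₂ eq))
        to : ∀ {b} → b ∈ concatMap (run v) L → b ∈ fib v
        to b∈ with x , x∈ , p ← find (∈-concatMap⁻ (run v) {xs = L} b∈) with i , _ , refl ← ∈-applyUpTo⁻ (pos v x a) p = ∈-fib v _
        from : ∀ {b} → b ∈ fib v → b ∈ concatMap (run v) L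
        from b∈ with z , _ , refl ← ∈-map⁻ (v ,_) b∈ with x , i , x∈ , i≤ , refl ← cover-run z =
          ∈-concatMap⁺ (run v) (lose x∈ (∈-applyUpTo⁺ (pos v x a) (s≤s i≤)))

      -- The point z - a lies on some run, and it is the last point of that run because the next
      -- step would reach z, an element of `L`. So the runs end in all of L - a, which is where the
      -- terms -σ(v) in β come from.
      slideL-surjective : ∀ {z} → z ∈ L → ∃[ x ] x ∈ L × slideL x ≡ z -ₙ a
      slideL-surjective {z} z∈ = let x , i , x∈ , i≤ , eq = cover-run (z -ₙ a) in
        x , x∈ , trans (cong (λ k → x +ₙ (k ·ₙ a)) (≤-antisym
          (≮⇒≥ (λ i< → steps-minimal x∈ i< (subst (_∈ L)
             (trans (sym (-ₙ-cancelʳ z a)) (trans (cong (_+ₙ a) eq) (+ₙ-suc x i a))) z∈))) i≤)) (sym eq)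

  -- The order in which `L` lists the progression is left open, because sliding permutes it.
  record Progression (d : ℕ) (γ : Z) (L : List Z) : Set where
    field
      unique : Unique L
      sound  : ∀ {x} → x ∈ L → ∃[ k ] k < d × x ≡ γ +ₙ (k ·ₙ r)
      full   : ∀ {k} → k < d → (γ +ₙ (k ·ₙ r)) ∈ L
  open Progression

  progression-cover : ∀ {d γ L} → Progression d γ L → ∀ a → gcd n (toℕ a) ≤ d →
    ∀ z → ∃[ x ] ∃[ i ] x ∈ L × z ≡ x +ₙ (i ·ₙ a)
  progression-cover {d} {γ} prog a g≤d z = let k , k<d , i , eq = coset-representative r coprime a g≤d (z -ₙ γ) in
    _ , i , full prog k<d ,
    trans (sym (-ₙ-cancelʳ z γ)) (trans (cong (_+ₙ γ) eq) (trans (+ₙ-comm _ γ) (sym (+ₙ-assoc γ _ _))))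

  next : List Z → Fin V → Fin V → Z → Z
  next L v w x = slideL L (σL v) x +ₙ σE v w

  -- One further loop step from the end of each run lands in `L`, which gives `sound`; `full` is
  -- `slideL-surjective`; `unique` holds because distinct runs are disjoint.
  next-progression : ∀ {d γ L} v w → gcd n (toℕ (σL v)) ≤ d → Progression d γ L →
    Progression d ((γ -ₙ σL v) +ₙ σE v w) (map (next L v w) L)
  next-progression {d} {γ} {L} v w g≤d prog = record
    { unique = unique-map (next L v w)
        (λ x∈ y∈ eq → proj₂ (runs-meet L a x∈ y∈ ≤-refl ≤-refl (+ₙ-cancelʳ e _ _ eq))) (unique prog)
    ; sound = λ x∈ → let y , y∈ , eq = ∈-map⁻ (next L v w) x∈
                         k , k<d , eq′ = sound prog (steps-hit L a y∈)
                     in k , k<d , trans eq (trans (cong (_+ₙ e) (trans (sym (+ₙ-cancel-ₙ (slideL L a y) a))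
                          (cong (_-ₙ a) (trans (+ₙ-suc y (steps L a y) a) eq′)))) (shuffle k))
    ; full = λ {k} k<d → let x , x∈ , eq = slideL-surjective L a (unique prog) (progression-cover prog a g≤d) (full prog k<d)
                     in subst (_∈ map (next L v w) L) (trans (cong (_+ₙ e) eq) (shuffle k)) (∈-map⁺ (next L v w) x∈)
    }
    where
    a e : Z
    a = σL v
    e = σE v w
    open CMS (AbelianGroup.commutativeMonoid +ₙ-abelianGroup) using (solve; _⊕_; _⊜_)
    shuffle : ∀ k → ((γ +ₙ (k ·ₙ r)) -ₙ a) +ₙ e ≡ ((γ -ₙ a) +ₙ e) +ₙ (k ·ₙ r)
    shuffle k = solve 4 (λ γ k a e → (((γ ⊕ k) ⊕ a) ⊕ e) ⊜ (((γ ⊕ a) ⊕ e) ⊕ k)) refl γ (k ·ₙ r) (-ₙ a) e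

  -- Meant for the path from its second vertex on, as no loop is used at the first one. The last
  -- vertex contributes nothing either: its fibre belongs to the far cycle and not to the bridge.
  trace : List Z → List (Fin V) → Z → List (Fin V × Z)
  trace L (v ∷ w ∷ rest) x = run L (σL v) v x ++ trace (map (next L v w) L) (w ∷ rest) (next L v w x)
  trace L _              x = []

  arrival : List Z → List (Fin V) → Z → Z
  arrival L (v ∷ w ∷ rest) x = arrival (map (next L v w) L) (w ∷ rest) (next L v w x)
  arrival L _              x = x

  trace-↭ : ∀ {d γ} L vs → Progression d γ L → (∀ {v} → v ∈ initL vs → gcd n (toℕ (σL v)) ≤ d) →
    concatMap (trace L vs) L ↭ concatMap fib (initL vs)
  trace-↭ L []             prog g≤d = ↭-reflexive (concatMap-[] L)
  trace-↭ L (v ∷ [])       prog g≤d = ↭-reflexive (concatMap-[] L)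
  trace-↭ L (v ∷ w ∷ rest) prog g≤d = begin
    concatMap (λ x → run L (σL v) v x ++ trace L′ (w ∷ rest) (next L v w x)) L
      ↭⟨ concatMap-++-↭ (run L (σL v) v) (trace L′ (w ∷ rest) ∘ next L v w) L ⟩
    concatMap (run L (σL v) v) L ++ concatMap (trace L′ (w ∷ rest) ∘ next L v w) L
      ≡⟨ cong (concatMap (run L (σL v) v) L ++_) (concatMap-map (trace L′ (w ∷ rest)) (next L v w) L) ⟨
    concatMap (run L (σL v) v) L ++ concatMap (trace L′ (w ∷ rest)) L′
      ↭⟨ ++⁺ (runs-↭ L (σL v) (unique prog) (progression-cover prog (σL v) (g≤d (here refl))) v)
             (trace-↭ L′ (w ∷ rest) (next-progression v w (g≤d (here refl)) prog) (g≤d ∘ there)) ⟩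
    fib v ++ concatMap fib (initL (w ∷ rest)) ∎
    where
    open PermutationReasoning
    L′ : List Z
    L′ = map (next L v w) L

  trace-path : ∀ L v rest x {p} → Linked Adj (v ∷ rest) → Adjᴸ p (v , x) →
    Path Adjᴸ p (trace L (v ∷ rest) x) (endV v rest , arrival L (v ∷ rest) x)
  trace-path L v []         x _         px = px
  trace-path L v (w ∷ rest) x (vw ∷ lk) px =
    subst (Adjᴸ _) (cong (v ,_) (sym (+ₙ-identityʳ x))) px ,
    path-applyUpTo (pos v x (σL v)) (steps L (σL v) x) (pos-step v x refl)
      (trace-path (map (next L v w) L) w rest (next L v w x) lk (inj₁ (vw , refl)))

  billiardFrom-lookup : ∀ {d} (xs : Vec Z d) vs j →
    lookup (billiardFrom σ xs vs) j ≡ arrival (toList xs) vs (lookup xs j)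
  billiardFrom-lookup xs []             j = refl
  billiardFrom-lookup xs (v ∷ [])       j = refl
  billiardFrom-lookup xs (v ∷ w ∷ rest) j = trans (billiardFrom-lookup (Vec.map f xs) (w ∷ rest) j)
    (cong₂ (λ L x → arrival L (w ∷ rest) x) (Vec.toList-map f xs) (Vec.lookup-map j f xs))
    where
    f : Z → Z
    f = next (toList xs) v w

-- From odd shifting paths to bridges

path-map : ∀ {A B : Set} {R : A → A → Set} {S : B → B → Set} (f : A → B) → (∀ {x y} → R x y → S (f x) (f y)) →
  ∀ {x y} xs → Path R x xs y → Path S (f x) (map f xs) (f y)
path-map f pres []       p       = pres p
path-map f pres (w ∷ ws) (r , p) = pres r , path-map f pres ws p

toList-tabulate : ∀ {A : Set} (f : ℕ → A) d → toList (tabulate {n = d} (f ∘ toℕ)) ≡ applyUpTo f d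
toList-tabulate f zero    = refl
toList-tabulate f (suc d) = cong (f 0 ∷_) (toList-tabulate (f ∘ suc) d)

last-endV : ∀ {A : Set} (v : A) vs → last (v ∷ vs) ≡ just (endV v vs)
last-endV v []       = refl
last-endV v (w ∷ ws) = last-endV w ws

isYes-true : ∀ {A : Set} (a? : Dec A) → A → isYes a? ≡ true
isYes-true (yes _) a = refl
isYes-true (no ¬a) a = ⊥-elim (¬a a)

isYes-false : ∀ {A : Set} (a? : Dec A) → ¬ A → isYes a? ≡ false
isYes-false (yes a) ¬a = ⊥-elim (¬a a)
isYes-false (no _)  ¬a = refl

2*≡double : ∀ m → 2 * m ≡ double m
2*≡double zero    = refl
2*≡double (suc m) = cong suc (trans (+-suc m (m + 0)) (cong suc (2*≡double m)))

double-+ : ∀ m k → double (m + k) ≡ double m + double k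
double-+ zero    k = refl
double-+ (suc m) k = cong (suc ∘ suc) (double-+ m k)

maxL-upper : ∀ {m} ms → m ∈ ms → m ≤ maxL ms
maxL-upper (m ∷ ms) (here refl) = m≤m⊔n m (maxL ms)
maxL-upper (m ∷ ms) (there p)   = ≤-trans (maxL-upper ms p) (m≤n⊔m m (maxL ms))

n≤2*⌈n/2⌉ : ∀ n → n ≤ 2 * ⌈ n /2⌉
n≤2*⌈n/2⌉ n = begin
  n ≡⟨ ⌊n/2⌋+⌈n/2⌉≡n n ⟨
  ⌊ n /2⌋ + ⌈ n /2⌉ ≤⟨ +-monoˡ-≤ _ (⌊n/2⌋≤⌈n/2⌉ n) ⟩
  ⌈ n /2⌉ + ⌈ n /2⌉ ≡⟨ cong (⌈ n /2⌉ +_) (+-identityʳ _) ⟨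
  2 * ⌈ n /2⌉ ∎
  where open ≤-Reasoning

module Bridging {V n : ℕ} .{{_ : NonZero n}} {G : SimpleGraph V} (σ : Voltage V n G)
  (r : Fin n) (coprime : Coprime (toℕ r) n) where
  open Billiard σ r coprime public

  -- Since c is half of the largest gcd, rounded up, 2c consecutive multiples of r are enough to
  -- meet every coset of the loop voltage in each inner fibre.
  gcd≤2cval : ∀ vs {v} → v ∈ interior vs → gcd n (toℕ (σL v)) ≤ 2 * cval σ vs
  gcd≤2cval vs v∈ with interior vs
  ... | i ∷ is = ≤-trans (maxL-upper _ (∈-map⁺ (λ v → gcd n (toℕ (σL v))) v∈)) (n≤2*⌈n/2⌉ _)

  seg : Fin V → Z → ℕ → List (Fin V × Z)
  seg v l = applyUpTo (pos v l r)

  fibs : List (Fin V) → List (Fin V × Z)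
  fibs = concatMap fib

  shift : Z → Fin V × Z → Fin V × Z
  shift l (v , z) = v , l +ₙ z

  -- Odd shifting speaks of the start l = 0 only. Translations are automorphisms of the lift, so
  -- they carry the bridges to any start.
  shift-Adjᴸ : ∀ l {x y} → Adjᴸ x y → Adjᴸ (shift l x) (shift l y)
  shift-Adjᴸ l {_ , a} (inj₁ (uv , refl))         = inj₁ (uv , sym (+ₙ-assoc l a _))
  shift-Adjᴸ l {_ , a} (inj₂ (refl , inj₁ refl))  = inj₂ (refl , inj₁ (sym (+ₙ-assoc l a _)))
  shift-Adjᴸ l {_ , a} (inj₂ (refl , inj₂ refl))  = inj₂ (refl , inj₂ (sym (+ₙ-assoc l a _)))

  shift-fibs : ∀ l vs → map (shift l) (fibs vs) ↭ fibs vs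
  shift-fibs l []       = ↭-refl
  shift-fibs l (v ∷ vs) = ↭-trans (↭-reflexive (map-++ (shift l) (fib v) (fibs vs))) (++⁺ fib-↭ (shift-fibs l vs))
    where
    inj : ∀ {x y} → shift l x ≡ shift l y → x ≡ y
    inj {_ , a} {_ , b} eq = cong₂ _,_ (cong proj₁ eq) (+ₙ-cancelˡ l a b (cong proj₂ eq))
    fib-↭ : map (shift l) (fib v) ↭ fib v
    fib-↭ = unique-↭ (Unique.map⁺ inj (fib-unique v)) (fib-unique v) to from
      where
      to : ∀ {x} → x ∈ map (shift l) (fib v) → x ∈ fib v
      to x∈ with y , y∈ , refl ← ∈-map⁻ (shift l) x∈ with refl ← ∈-fib⁻ y∈ = ∈-fib v _
      from : ∀ {x} → x ∈ fib v → x ∈ map (shift l) (fib v)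
      from {_ , z} x∈ with refl ← ∈-fib⁻ x∈ = subst (λ z′ → (v , z′) ∈ map (shift l) (fib v))
        (trans (+ₙ-comm l (z -ₙ l)) (-ₙ-cancelʳ z l)) (∈-map⁺ (shift l) (∈-fib v (z -ₙ l)))

  -- `e` and `t` express that d - s = 2e + 1 and s = 2t + 1 are both odd, in the form which the
  -- merge uses. The bridges depend on the start `l` because a reserved interval may lie anywhere in
  -- the fibre.
  record Bridges (h w : Fin V) (inner : List (Fin V)) (d : ℕ) : Set where
    field
      e t   : ℕ
      d-eq  : d ≡ suc (double e) + suc (double t)
      β     : Z
      P     : Z → ℕ → List (Fin V × Z)
      br₁   : ∀ l j → j < suc (double e) → Path Adjᴸ (pos h l r j) (P l j) (pos w (l +ₙ β) r (suc (double t) + j))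
      br₂   : ∀ l k → k < suc (double t) →
              Path Adjᴸ (pos h l r (suc (double e) + k)) (P l (suc (double e) + k)) (pos w (l +ₙ β) r k)
      cover : ∀ l → concat (applyUpTo (P l) d) ↭ fibs inner
      σL-h  : σL h ≡ r
      σL-w  : σL w ≡ r

  2cval≤n : ∀ vs → OddShifting σ vs r → 2 * cval σ vs ≤ n
  2cval≤n vs (_ , _ , _ , 2c≤n/g , _) = ≤-trans 2c≤n/g (m/n≤m n (gcd (toℕ r) n) {{gcdNZ σ r}})

  oddShifting⇒bridges : ∀ h v rest → Linked Adj (h ∷ v ∷ rest) → OddShifting σ (h ∷ v ∷ rest) r →
    Bridges h (endV v rest) (initL (v ∷ rest)) (2 * cval σ (h ∷ v ∷ rest))
  oddShifting⇒bridges h v rest (hv ∷ lk) os@(_ , eq-h , eq-w , _ , s , (t , refl) , _ , s<d , arrive) = record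
    { e = e ; t = t ; d-eq = d-eq ; β = β
    ; P = P
    -- The hypothesis lists the paths by their place of arrival. Inverting it: a_k = j for k = s +
    -- j, and in `br₂` a_k = o + k for k < s.
    ; br₁ = λ l j j<o → subst (λ m → Path Adjᴸ (pos h l r j) (P l j) (pos (endV v rest) (l +ₙ β) r (m + j))) s≡
        (bridge l (<-≤-trans j<o (subst (o ≤_) (sym d-eq) (m≤m+n o _)))
          (subst (_< d) (+-comm j s) (subst (j + s <_) (sym d≡o+s) (+-monoˡ-< s {j} {o} j<o)))
          (sym (trans (aIndex-≥ (s + j) (≤⇒≯ (m≤m+n s j))) (m+n∸m≡n s j))))
    ; br₂ = λ l k k<s′ → let k<s = subst (k <_) (sym s≡) k<s′ in
        bridge l (subst (o + k <_) (sym d≡o+s) (+-monoʳ-< o k<s))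
          (<-trans k<s s<d) (sym (trans (aIndex-< k k<s) (cong (_+ k) d∸s≡o)))
    ; cover = λ l → begin
        concat (applyUpTo (P l) d)                       ≡⟨ cong concat (map-applyUpTo T₁ (map (shift l)) d) ⟨
        concat (map (map (shift l)) (applyUpTo T₁ d))    ≡⟨ concat-map (applyUpTo T₁ d) ⟩
        map (shift l) (concat (applyUpTo T₁ d))          ≡⟨ cong (map (shift l) ∘ concat) (map-applyUpTo entry (trace L₁ (v ∷ rest)) d) ⟨
        map (shift l) (concatMap (trace L₁ (v ∷ rest)) (applyUpTo entry d)) ≡⟨ cong (map (shift l) ∘ concatMap (trace L₁ (v ∷ rest))) L₁-eq ⟨
        map (shift l) (concatMap (trace L₁ (v ∷ rest)) L₁) ↭⟨ Perm.map⁺ (shift l) (trace-↭ L₁ (v ∷ rest) prog (gcd≤2cval (h ∷ v ∷ rest))) ⟩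
        map (shift l) (fibs (initL (v ∷ rest)))          ↭⟨ shift-fibs l (initL (v ∷ rest)) ⟩
        fibs (initL (v ∷ rest))                          ∎
    ; σL-h = just-injective eq-h
    ; σL-w = just-injective (trans (cong (Maybe.map σL) (sym (last-endV v rest))) eq-w)
    }
    where
    open PermutationReasoning
    -- From 2t + 1 < 2c follows t < c. The difference c - t - 1 is `e`, since d - s = 2(c - t - 1) +
    -- 1.
    half : ∃[ m ] suc t + m ≡ cval σ (h ∷ v ∷ rest)
    half = m≤n⇒∃[o]m+o≡n (*-cancelˡ-< 2 t _ (<-trans (n<1+n _) s<d))
    d o e : ℕ
    d = 2 * cval σ (h ∷ v ∷ rest)
    e = proj₁ half
    o = suc (double e)
    β : Z
    β = beta σ (h ∷ v ∷ rest)

    d-eq : d ≡ o + suc (double t)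
    d-eq = trans (cong (2 *_) (sym (proj₂ half)))
      (trans (2*≡double (suc t + e)) (trans (cong (suc ∘ suc) (trans (cong double (+-comm t e)) (double-+ e t)))
        (cong suc (sym (+-suc (double e) (double t))))))

    s≡ : s ≡ suc (double t)
    s≡ = cong suc (2*≡double t)

    d≡o+s : d ≡ o + s
    d≡o+s = trans d-eq (cong (o +_) (sym s≡))

    d∸s≡o : d ∸ s ≡ o
    d∸s≡o = trans (cong (_∸ s) d≡o+s) (m+n∸n≡m o s)

    aIndex-< : ∀ k → k < s → aIndex σ d s k ≡ (d ∸ s) + k
    aIndex-< k k<s = cong (λ b → if b then (d ∸ s) + k else k ∸ s) (isYes-true (k <? s) k<s)

    aIndex-≥ : ∀ k → ¬ k < s → aIndex σ d s k ≡ k ∸ s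
    aIndex-≥ k k≮s = cong (λ b → if b then (d ∸ s) + k else k ∸ s) (isYes-false (k <? s) k≮s)

    f : Z → Z
    f x = x +ₙ σE h v

    origin entry : ℕ → Z
    origin j = 0ₙ +ₙ (j ·ₙ r)
    entry j = f (origin j)

    L₁ : List Z
    L₁ = toList (Vec.map f (tabulate {n = d} (origin ∘ toℕ)))

    L₁-eq : L₁ ≡ applyUpTo entry d
    L₁-eq = trans (Vec.toList-map f _) (trans (cong (map f) (toList-tabulate origin d)) (map-applyUpTo origin f d))

    entry-eq : ∀ j → entry j ≡ σE h v +ₙ (j ·ₙ r)
    entry-eq j = trans (cong f (+ₙ-identityˡ (j ·ₙ r))) (+ₙ-comm (j ·ₙ r) (σE h v))

    prog : Progression d (σE h v) L₁
    prog = record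
      { unique = subst Unique (sym L₁-eq) (Unique.applyUpTo⁺₁ entry d (λ {i} {j} i<j j<d eq → <⇒≢ i<j
          (·ₙ-injective r coprime (<-trans i<j (<-≤-trans j<d d≤n)) (<-≤-trans j<d d≤n)
            (+ₙ-cancelˡ (σE h v) _ _ (trans (sym (entry-eq i)) (trans eq (entry-eq j)))))))
      ; sound = λ x∈ → let j , j<d , eq = ∈-applyUpTo⁻ entry (subst (_ ∈_) L₁-eq x∈) in j , j<d , trans eq (entry-eq j)
      ; full = λ {k} k<d → subst₂ _∈_ (entry-eq k) (sym L₁-eq) (∈-applyUpTo⁺ entry k<d)
      }
      where
      d≤n : d ≤ n
      d≤n = 2cval≤n (h ∷ v ∷ rest) os

    T₁ : ℕ → List (Fin V × Z)
    T₁ j = trace L₁ (v ∷ rest) (entry j)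

    P : Z → ℕ → List (Fin V × Z)
    P l j = map (shift l) (T₁ j)

    arrival-eq : ∀ {j k} (j<d : j < d) (k<d : k < d) → j ≡ aIndex σ d s k → arrival L₁ (v ∷ rest) (entry j) ≡ β +ₙ (k ·ₙ r)
    arrival-eq {j} {k} j<d k<d eq = trans
      (trans (cong (λ i → arrival L₁ (v ∷ rest) (entry i)) (sym (toℕ-fromℕ< j<d)))
        (trans (cong (arrival L₁ (v ∷ rest)) (sym (trans (Vec.lookup-map (fromℕ< j<d) f (tabulate (origin ∘ toℕ))) (cong f (Vec.lookup∘tabulate (origin ∘ toℕ) (fromℕ< j<d))))))
          (sym (billiardFrom-lookup _ (v ∷ rest) (fromℕ< j<d)))))
      (trans (arrive (fromℕ< k<d) (fromℕ< j<d) (trans (toℕ-fromℕ< j<d) (trans eq (cong (aIndex σ d s) (sym (toℕ-fromℕ< k<d))))))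
        (cong (λ i → β +ₙ (i ·ₙ r)) (toℕ-fromℕ< k<d)))

    bridge : ∀ l {j k} → j < d → k < d → j ≡ aIndex σ d s k → Path Adjᴸ (pos h l r j) (P l j) (pos (endV v rest) (l +ₙ β) r k)
    bridge l {j} {k} j<d k<d eq = subst₂ (λ x y → Path Adjᴸ (h , x) (P l j) (endV v rest , y))
      (cong (l +ₙ_) (+ₙ-identityˡ (j ·ₙ r)))
      (trans (cong (l +ₙ_) (arrival-eq j<d k<d eq)) (sym (+ₙ-assoc l β (k ·ₙ r))))
      (path-map (shift l) (shift-Adjᴸ l) (T₁ j) (trace-path L₁ v rest (entry j) lk (inj₁ (hv , refl))))

  -- The remainders `R₁` and `R₂` occur unbroken and not reversed, so all intervals reserved inside
  -- them survive.
  record Merged (C₁ C₂ B R₁ R₂ : List (Fin V × Z)) : Set where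
    constructor merged
    field
      M₁ M₂  : List (Fin V × Z)
      cyclic : Cyc Adjᴸ (M₁ ++ R₂ ++ M₂ ++ R₁)
      covers : M₁ ++ R₂ ++ M₂ ++ R₁ ↭ C₁ ++ C₂ ++ B

  -- The order of quantifiers matters: `l′` depends on `l` alone and is known before the far cycle
  -- is built.
  Joins : Fin V → Fin V → List (Fin V) → ℕ → Set
  Joins u w inner d = ∀ l → ∃[ l′ ] (∀ R₁ R₂ → Cyc Adjᴸ (seg u l d ++ R₁) → Cyc Adjᴸ (seg w l′ d ++ R₂) →
    Merged (seg u l d ++ R₁) (seg w l′ d ++ R₂) (fibs inner) R₁ R₂)

  module _ {h w inner d} (B : Bridges h w inner d) where
    open Bridges B

    bridges-merge : ∀ l R₁ R₂ → Cyc Adjᴸ (seg h l d ++ R₁) → Cyc Adjᴸ (seg w (l +ₙ β) d ++ R₂) →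
      Merged (seg h l d ++ R₁) (seg w (l +ₙ β) d ++ R₂) (fibs inner) R₁ R₂
    bridges-merge l R₁ R₂ = subst (λ k → Cyc Adjᴸ (seg h l k ++ R₁) → Cyc Adjᴸ (seg w (l +ₙ β) k ++ R₂) →
        Merged (seg h l k ++ R₁) (seg w (l +ₙ β) k ++ R₂) (fibs inner) R₁ R₂) (sym d-eq) λ c₁ c₂ →
      merged (mergeHead x z (P l) e t R₁ R₂) (mergeTail x z (P l) e t R₁ R₂)
      (merge-cyc x z (P l) e t R₁ R₂ Adjᴸ-sym (pos-step h l σL-h) (pos-step w (l +ₙ β) σL-w) (br₁ l) (br₂ l)
        (subst (λ i → Path Adjᴸ (x i) R₁ (x 0)) (+-suc (double e) (double t)) (path-drop x (double e + suc (double t)) c₁))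
        (subst (λ i → Path Adjᴸ (z i) R₂ (z 0)) (trans (+-suc (double e) (double t)) (cong suc (+-comm (double e) (double t))))
          (path-drop z (double e + suc (double t)) c₂)))
      (↭-trans (merge-↭ x z (P l) e t R₁ R₂) (++⁺ˡ (seg h l D ++ R₁) (++⁺ˡ (seg w (l +ₙ β) D ++ R₂)
        (subst (λ k → concat (applyUpTo (P l) k) ↭ fibs inner) d-eq (cover l)))))
      where
      open Weave {A = Fin V × Z}
      D : ℕ
      D = suc (double e) + suc (double t)
      x z : ℕ → Fin V × Z
      x = pos h l r
      z = pos w (l +ₙ β) r

    bridges⇒joins : Joins h w inner d
    bridges⇒joins l = l +ₙ β , bridges-merge l

    -- No second family of bridges is built. The same merge is applied with the two cycles
    -- exchanged, and its result M₁ R₁ M₂ R₂ is rotated to M₂ R₂ M₁ R₁.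
    bridges⇒joinsʳ : Joins w h inner d
    bridges⇒joinsʳ l = l -ₙ β , λ R₁ R₂ c₁ c₂ →
      let merged M₁ M₂ cyc perm = bridges-merge (l -ₙ β) R₂ R₁ c₂ (subst (λ m → Cyc Adjᴸ (seg w m d ++ R₁)) (sym (-ₙ-cancelʳ l β)) c₁)
      in merged M₂ M₁
         (subst (Cyc Adjᴸ) (++-assoc M₂ R₂ (M₁ ++ R₁)) (cyc-rotate (M₁ ++ R₁) (M₂ ++ R₂) (subst (Cyc Adjᴸ) (sym (++-assoc M₁ R₁ (M₂ ++ R₂))) cyc)))
         (↭-trans (solve 4 (λ M₁ M₂ R₁ R₂ → (M₂ ⊕ (R₂ ⊕ (M₁ ⊕ R₁))) ⊜ (M₁ ⊕ (R₁ ⊕ (M₂ ⊕ R₂)))) ↭-refl M₁ M₂ R₁ R₂)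
         (↭-trans perm
         (↭-trans (↭-reflexive (cong (λ m → (seg h (l -ₙ β) d ++ R₂) ++ (seg w m d ++ R₁) ++ fibs inner) (-ₙ-cancelʳ l β)))
           (solve 3 (λ a b c → (a ⊕ (b ⊕ c)) ⊜ (b ⊕ (a ⊕ c))) ↭-refl (seg h (l -ₙ β) d ++ R₂) (seg w l d ++ R₁) (fibs inner)))))
      where open CMS (++-commutativeMonoid {A = Fin V × Z}) using (solve; _⊕_; _⊜_)

-- Simple paths and the edges of a vertex list

path-mono : ∀ {A : Set} {R S : A → A → Set} → (∀ {x y} → R x y → S x y) → ∀ {x y} xs → Path R x xs y → Path S x xs y
path-mono R⇒S []       r       = R⇒S r
path-mono R⇒S (w ∷ ws) (r , p) = R⇒S r , path-mono R⇒S ws p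

path⇒star : ∀ {A : Set} {R : A → A → Set} {x y z} xs → Path R x xs y → z ∈ xs ++ [ y ] → Star R x z
path⇒star []       r       (here refl) = r ◅ ε
path⇒star (w ∷ ws) (r , p) (here refl) = r ◅ ε
path⇒star (w ∷ ws) (r , p) (there z∈)  = r ◅ path⇒star ws p z∈

path-targets : ∀ {A : Set} {R : A → A → Set} {P : A → Set} → (∀ {x y} → R x y → P y) →
  ∀ {x y z} xs → Path R x xs y → z ∈ xs → P z
path-targets tgt (w ∷ ws) (r , p) (here refl) = tgt r
path-targets tgt (w ∷ ws) (r , p) (there z∈)  = path-targets tgt ws p z∈

unique-suffix : ∀ {A : Set} (xs : List A) {ys} → Unique (xs ++ ys) → Unique ys
unique-suffix []       u       = u
unique-suffix (x ∷ xs) (_ ∷ u) = unique-suffix xs u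

unique-∷ʳ : ∀ {A : Set} (xs : List A) {y} → Unique (xs ++ [ y ]) → Unique xs × y ∉ xs
unique-∷ʳ []       u        = [] , λ ()
unique-∷ʳ (x ∷ xs) {y} (x∉ ∷ u) =
  All.tabulate (λ z∈ → All.lookup x∉ (∈-++⁺ˡ z∈)) ∷ proj₁ (unique-∷ʳ xs u) ,
  λ { (here refl) → All.lookup x∉ (∈-++⁺ʳ xs (here refl)) refl ; (there y∈) → proj₂ (unique-∷ʳ xs u) y∈ }

Unique-resp-↭ : ∀ {A : Set} {xs ys : List A} → xs ↭ ys → Unique xs → Unique ys
Unique-resp-↭ {A} p = SetoidPerm.Unique-resp-↭ (setoid A) (Perm.↭⇒↭ₛ p)

module _ {m : ℕ} {R : Fin m → Fin m → Set} where
  open DecMembership (_≟_ {m}) using (_∈?_)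

  -- Loop erasure: when x recurs on the simple path found for the remaining steps, only the part
  -- after that occurrence is kept.
  star⇒simplePath : ∀ {x y} → Star R x y → x ≡ y ⊎ ∃[ p ] Path R x p y × Unique (x ∷ p ++ [ y ])
  star⇒simplePath ε = inj₁ refl
  star⇒simplePath {x} {y} (_◅_ {j = w} r rs) with star⇒simplePath rs
  ... | inj₁ refl with x ≟ w
  ...   | yes eq = inj₁ eq
  ...   | no neq = inj₂ ([] , r , (neq ∷ []) ∷ [] ∷ [])
  star⇒simplePath {x} {y} (_◅_ {j = w} r rs) | inj₂ (p , pth , u) with x ∈? (w ∷ p ++ [ y ])
  ... | no x∉           = inj₂ (w ∷ p , (r , pth) , ¬Any⇒All¬ _ x∉ ∷ u)
  ... | yes (here refl) = inj₂ (p , pth , u)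
  ... | yes (there x∈) with ∈-++⁻ p x∈
  ...   | inj₂ (here refl) = inj₁ refl
  ...   | inj₁ x∈p with p₁ , p₂ , refl ← ∈-∃++ x∈p =
    inj₂ (p₂ , proj₂ (path-split p₁ pth) ,
      unique-suffix (w ∷ p₁) (subst (λ l → Unique (w ∷ l)) (++-assoc p₁ (x ∷ p₂) [ y ]) u))

init-end : ∀ {A : Set} (v : A) vs → v ∷ vs ≡ initL (v ∷ vs) ++ [ endV v vs ]
init-end v []       = refl
init-end v (w ∷ ws) = cong (v ∷_) (init-end w ws)

consecIn⇒ : ∀ {A : Set} {R : A → A → Set} {x y : A} xs → Linked R xs → ConsecIn xs x y → R x y
consecIn⇒ (_ ∷ _ ∷ _)  (r ∷ _)  (inj₁ (refl , refl)) = r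
consecIn⇒ (_ ∷ b ∷ xs) (_ ∷ lk) (inj₂ c)             = consecIn⇒ (b ∷ xs) lk c

consecIn⇒∈ : ∀ {A : Set} {x y : A} xs → ConsecIn xs x y → x ∈ xs × y ∈ xs
consecIn⇒∈ (_ ∷ _ ∷ _)  (inj₁ (refl , refl)) = here refl , there (here refl)
consecIn⇒∈ (_ ∷ b ∷ xs) (inj₂ c)             = let p , q = consecIn⇒∈ (b ∷ xs) c in there p , there q

edgeIn⇒∈ : ∀ {A : Set} {x y : A} xs → EdgeIn xs x y → x ∈ xs × y ∈ xs
edgeIn⇒∈ xs (inj₁ c) = consecIn⇒∈ xs c
edgeIn⇒∈ xs (inj₂ c) = let p , q = consecIn⇒∈ xs c in q , p

consecIn-path : ∀ {A : Set} (x : A) xs y → Path (ConsecIn (x ∷ xs ++ [ y ])) x xs y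
consecIn-path x []       y = inj₁ (refl , refl)
consecIn-path x (w ∷ ws) y = inj₁ (refl , refl) , path-mono inj₂ ws (consecIn-path w ws y)

isEndpoint⇒ : ∀ {V} (h v : Fin V) rest {x} → T (isEndpoint (h ∷ v ∷ rest) x) → x ≡ h ⊎ x ≡ endV v rest
isEndpoint⇒ h v rest {x} ep with Equivalence.to T-∨ ep
... | inj₁ p = inj₁ (sym (toWitness {a? = h ≟ x} p))
... | inj₂ p = inj₂ (sym (toWitness {a? = endV v rest ≟ x} (subst (λ m → T (eqMaybe m x)) (last-endV v rest) p)))

⇒isEndpoint : ∀ {V} (h v : Fin V) rest {x} → x ≡ h ⊎ x ≡ endV v rest → T (isEndpoint (h ∷ v ∷ rest) x)
⇒isEndpoint h v rest (inj₁ refl) = Equivalence.from T-∨ (inj₁ (fromWitness {a? = h ≟ h} refl))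
⇒isEndpoint h v rest {x} (inj₂ refl) = Equivalence.from T-∨ (inj₂
  (subst (λ m → T (eqMaybe m x)) (sym (last-endV v rest)) (fromWitness {a? = x ≟ x} refl)))

-- Cycles with reserved intervals

module Assembly {V n : ℕ} .{{_ : NonZero n}} {G : SimpleGraph V} (σ : Voltage V n G)
  (r : Fin n) (coprime : Coprime (toℕ r) n) (k : ℕ) (Q : Fin k → List (Fin V))
  (decomposition : OddShiftingDecomposition σ k Q r) where
  open Bridging σ r coprime public

  d : Fin k → ℕ
  d i = 2 * cval σ (Q i)

  -- slot i v l reserves d i consecutive vertices of the fibre of v, starting at l, for a later merge along Q i;
  -- a list of items describes a cycle together with its reserved, pairwise disjoint subpaths.
  data Item : Set where
    slot   : Fin k → Fin V → Z → Item
    vertex : Fin V × Z → Item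

  expand : Item → List (Fin V × Z)
  expand (slot i v l) = seg v l (d i)
  expand (vertex x)   = [ x ]

  flat : List Item → List (Fin V × Z)
  flat = concatMap expand

  flat-vertex : ∀ xs → flat (map vertex xs) ≡ xs
  flat-vertex []       = refl
  flat-vertex (x ∷ xs) = cong (x ∷_) (flat-vertex xs)

  record Pulled (i : Fin k) (v : Fin V) (l : Z) (its : List Item) : Set where
    field
      others : List Item
      cyclic : Cyc Adjᴸ (seg v l (d i) ++ flat others)
      splits : flat its ↭ seg v l (d i) ++ flat others
      keeps  : ∀ {j u m} → j ≢ i → slot j u m ∈ its → slot j u m ∈ others

  abstract
    pull-slot : ∀ {i v l} its → slot i v l ∈ its → Cyc Adjᴸ (flat its) → Pulled i v l its
    pull-slot {i} {v} {l} its s∈ cyc with xs , ys , refl ← ∈-∃++ s∈ = record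
      { others = ys ++ xs
      ; cyclic = subst (Cyc Adjᴸ) eq (cyc-rotate (flat xs) (seg v l (d i) ++ flat ys) (subst (Cyc Adjᴸ) (concatMap-++ expand xs (slot i v l ∷ ys)) cyc))
      ; splits = ↭-trans (↭-reflexive (concatMap-++ expand xs (slot i v l ∷ ys))) (↭-trans (Perm.++-comm (flat xs) _) (↭-reflexive eq))
      ; keeps = λ j≢i j∈ → [ ∈-++⁺ʳ ys , (λ { (here refl) → ⊥-elim (j≢i refl) ; (there p) → ∈-++⁺ˡ p }) ]′ (∈-++⁻ xs j∈)
      }
      where
      eq : (seg v l (d i) ++ flat ys) ++ flat xs ≡ seg v l (d i) ++ flat (ys ++ xs)
      eq = trans (++-assoc (seg v l (d i)) (flat ys) (flat xs)) (cong (seg v l (d i) ++_) (sym (concatMap-++ expand ys xs)))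

  module Layout (w : Fin V) where

    weight : Fin k → ℕ
    weight i = if isEndpoint (Q i) w then d i else 0

    layout : List (Fin k) → Z → ℕ → List Item
    layout []       b p = []
    layout (j ∷ js) b p with isEndpoint (Q j) w
    ... | true  = slot j w (b +ₙ (p ·ₙ r)) ∷ layout js b (p + d j)
    ... | false = layout js b p

    flat-layout : ∀ js b p → flat (layout js b p) ≡ applyUpTo (pos w b r ∘ (p +_)) (sum (map weight js))
    flat-layout []       b p = refl
    flat-layout (j ∷ js) b p with isEndpoint (Q j) w
    ... | false = flat-layout js b p
    ... | true  = trans (cong₂ _++_
      (applyUpTo-cong (d j) (λ i _ → cong (w ,_) (+ₙ-shift b p i r)))
      (trans (flat-layout js b (p + d j)) (applyUpTo-cong (sum (map weight js)) (λ i _ → cong (pos w b r) (+-assoc p (d j) i)))))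
      (sym (applyUpTo-+ (pos w b r ∘ (p +_)) (d j) (sum (map weight js))))

    -- The offset is the same for every base `b`, so the base can be chosen afterwards to bring one
    -- given slot to a prescribed position.
    offset : ∀ js {j} p → j ∈ js → T (isEndpoint (Q j) w) → ∃[ o ] (∀ b → slot j w (b +ₙ (o ·ₙ r)) ∈ layout js b p)
    offset (j ∷ js) p (here refl) ep with isEndpoint (Q j) w
    ... | true = p , λ b → here refl
    offset (j ∷ js) p (there j∈) ep with isEndpoint (Q j) w
    ... | true  = let o , in-layout = offset js (p + d j) j∈ ep in o , there ∘ in-layout
    ... | false = offset js p j∈ ep

  seg-↭-fib : ∀ v b → seg v b n ↭ fib v
  seg-↭-fib v b = unique-↭
    (Unique.applyUpTo⁺₁ (pos v b r) n (λ i<j j<n eq → <⇒≢ i<j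
      (·ₙ-injective r coprime (<-trans i<j j<n) j<n (+ₙ-cancelˡ b _ _ (cong proj₂ eq)))))
    (fib-unique v) to from
    where
    to : ∀ {x} → x ∈ seg v b n → x ∈ fib v
    to x∈ with _ , _ , refl ← ∈-applyUpTo⁻ (pos v b r) x∈ = ∈-fib v _
    from : ∀ {x} → x ∈ fib v → x ∈ seg v b n
    from {_ , z} x∈ with refl ← ∈-fib⁻ x∈ =
      subst (_∈ seg v b n) (cong (v ,_) (trans (cong (b +ₙ_) (trans reduce (proj₂ (·ₙ-surjective r coprime (z -ₙ b)))))
        (trans (+ₙ-comm b _) (-ₙ-cancelʳ z b)))) (∈-applyUpTo⁺ (pos v b r) (m%n<n u n))
      where
      u : ℕ
      u = proj₁ (·ₙ-surjective r coprime (z -ₙ b))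
      reduce : (u % n) ·ₙ r ≡ u ·ₙ r
      reduce = sym (trans (cong (_·ₙ r) (m≡m%n+[m/n]*n u n)) (trans (·ₙ-distrib-+ (u % n) _ r)
        (trans (cong (((u % n) ·ₙ r) +ₙ_) ([q*n]·ₙ (u / n) r)) (+ₙ-identityʳ _))))

  seg-cyc : ∀ v b → σL v ≡ r → Cyc Adjᴸ (seg v b n)
  seg-cyc v b eq = subst (λ m → Cyc Adjᴸ (seg v b m)) 1+[n∸1]≡n (subst (λ l → Path Adjᴸ (pos v b r 0) l (pos v b r 0)) (++-identityʳ (applyUpTo (pos v b r ∘ suc) (n ∸ 1)))
    (path-applyUpTo (pos v b r) (n ∸ 1) (pos-step v b eq)
      (subst (Adjᴸ (pos v b r (n ∸ 1))) (cong (v ,_) (cong (b +ₙ_) (trans (cong (_·ₙ r) 1+[n∸1]≡n) (n·ₙ r)))) (pos-step v b eq (n ∸ 1)))))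

  record FibreItems (w : Fin V) (i : Fin k) (l : Z) : Set where
    field
      items  : List Item
      cyclic : Cyc Adjᴸ (flat items)
      covers : flat items ↭ fib w
      anchor : slot i w l ∈ items
      slots  : ∀ {j} → T (isEndpoint (Q j) w) → ∃[ m ] slot j w m ∈ items

  abstract
    fibre-items : ∀ {w i} → σL w ≡ r → Ω σ k Q w ≤ n → T (isEndpoint (Q i) w) → ∀ l → FibreItems w i l
    fibre-items {w} {i} eq Ω≤n ep l = record
      { items = its
      ; cyclic = subst (Cyc Adjᴸ) (sym flat-its) (seg-cyc w b eq)
      ; covers = ↭-trans (↭-reflexive flat-its) (seg-↭-fib w b)
      ; anchor = subst (λ m → slot i w m ∈ its) (-ₙ-cancelʳ l (o ·ₙ r)) (∈-++⁺ˡ (proj₂ (offset (allFin k) 0 (∈-allFin i) ep) b))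
      ; slots = λ {j} ep′ → let _ , in-layout = offset (allFin k) 0 (∈-allFin j) ep′ in _ , ∈-++⁺ˡ (in-layout b)
      }
      where
      open Layout w
      o W : ℕ
      o = proj₁ (offset (allFin k) 0 (∈-allFin i) ep)
      W = Ω σ k Q w
      b : Z
      b = l -ₙ (o ·ₙ r)
      -- The n - Ω unreserved vertices close the fibre cycle. By proper weighting the slots in front
      -- of them go round the fibre at most once.
      tail : List (Fin V × Z)
      tail = applyUpTo (pos w b r ∘ (W +_)) (n ∸ W)
      its : List Item
      its = layout (allFin k) b 0 ++ map vertex tail
      flat-its : flat its ≡ seg w b n
      flat-its = trans (concatMap-++ expand (layout (allFin k) b 0) (map vertex tail))
        (trans (cong₂ _++_ (flat-layout (allFin k) b 0) (flat-vertex tail))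
        (trans (sym (applyUpTo-+ (pos w b r) W (n ∸ W))) (cong (seg w b) (m+[n∸m]≡n Ω≤n))))

  fibs-resp-↭ : ∀ {us vs} → us ↭ vs → fibs us ↭ fibs vs
  fibs-resp-↭ Perm.refl         = ↭-refl
  fibs-resp-↭ (prep v p)        = ++⁺ˡ (fib v) (fibs-resp-↭ p)
  fibs-resp-↭ (Perm.swap u v p) = ↭-trans (++⁺ˡ (fib u) (++⁺ˡ (fib v) (fibs-resp-↭ p)))
    (solve 3 (λ a b c → (a ⊕ (b ⊕ c)) ⊜ (b ⊕ (a ⊕ c))) ↭-refl (fib u) (fib v) _)
    where open CMS (++-commutativeMonoid {A = Fin V × Z}) using (solve; _⊕_; _⊜_)
  fibs-resp-↭ (Perm.trans p q)  = ↭-trans (fibs-resp-↭ p) (fibs-resp-↭ q)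

  Edge : Fin k → Fin V → Fin V → Set
  Edge i = EdgeIn (Q i)

  edge-Adj : ∀ i {u v} → Edge i u v → Adj u v
  edge-Adj i (inj₁ c) = consecIn⇒ (Q i) (proj₂ (proj₁ (proj₁ decomposition i))) c
  edge-Adj i (inj₂ c) = Adj-sym (consecIn⇒ (Q i) (proj₂ (proj₁ (proj₁ decomposition i))) c)

  record Traversal (i : Fin k) (u w : Fin V) : Set where
    field
      inner      : List (Fin V)
      members    : Q i ↭ u ∷ w ∷ inner
      edges      : Path (Edge i) u inner w
      endpoint   : ∀ {v} → T (isEndpoint (Q i) v) → v ≡ u ⊎ v ≡ w
      endpoint-u : T (isEndpoint (Q i) u)
      endpoint-w : T (isEndpoint (Q i) w)
      joins      : Joins u w inner (d i)
      σL-w       : σL w ≡ r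

    distinct : Unique (u ∷ w ∷ inner)
    distinct = Unique-resp-↭ members (proj₁ (proj₁ (proj₁ decomposition i)))

    inner∈ : ∀ {v} → v ∈ inner → v ∈ Q i
    inner∈ v∈ = ∈-resp-↭ (↭-sym members) (there (there v∈))

    u≢w : u ≢ w
    u≢w with (u≢ ∷ _) ∷ _ ← distinct = u≢

    inner-not-endpoint : ∀ {v} → v ∈ inner → ¬ T (isEndpoint (Q i) v)
    inner-not-endpoint v∈ ep with (_ ∷ u∉) ∷ (w∉ ∷ _) ← distinct | endpoint ep
    ... | inj₁ refl = All.lookup u∉ v∈ refl
    ... | inj₂ refl = All.lookup w∉ v∈ refl

  -- Both readings of `Q i` are needed, since the growing cycle may reach the path at either end.
  traversals : ∀ i → ∃[ h ] ∃[ w ] Traversal i h w × Traversal i w h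
  traversals i with Q i in eq | proj₁ decomposition i
  ... | [] | _ , () , _
  ... | _ ∷ [] | _ , s≤s () , _
  ... | h ∷ v ∷ rest | (_ , lk) , os = h , w , forward , backward
    where
    w : Fin V
    w = endV v rest
    q : List (Fin V)
    q = initL (v ∷ rest)
    Q-eq : Q i ≡ h ∷ q ++ [ w ]
    Q-eq = trans eq (cong (h ∷_) (init-end v rest))
    bridges : Bridges h w q (d i)
    bridges = subst (λ l → Bridges h w q (2 * cval σ l)) (sym eq) (oddShifting⇒bridges h v rest lk os)
    ends : ∀ {x} → T (isEndpoint (Q i) x) → x ≡ h ⊎ x ≡ w
    ends {x} ep = isEndpoint⇒ h v rest (subst (λ l → T (isEndpoint l x)) eq ep)
    ends⁻ : ∀ {x} → x ≡ h ⊎ x ≡ w → T (isEndpoint (Q i) x)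
    ends⁻ {x} p = subst (λ l → T (isEndpoint l x)) (sym eq) (⇒isEndpoint h v rest p)
    members : Q i ↭ h ∷ w ∷ q
    members = ↭-trans (↭-reflexive Q-eq) (prep h (Perm.++-comm q [ w ]))
    edges : Path (Edge i) h q w
    edges = subst (λ l → Path (EdgeIn l) h q w) (sym Q-eq) (path-mono inj₁ q (consecIn-path h q w))
    forward : Traversal i h w
    forward = record
      { inner = q ; members = members ; edges = edges ; endpoint = ends ; endpoint-u = ends⁻ (inj₁ refl)
      ; endpoint-w = ends⁻ (inj₂ refl) ; joins = bridges⇒joins bridges ; σL-w = Bridges.σL-w bridges }
    backward : Traversal i w h
    backward = record
      { inner = reverse q
      ; members = ↭-trans members (Perm.swap h w (↭-sym (↭-reverse q)))
      ; edges = path-reverse Sum.swap q edges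
      ; endpoint = Sum.swap ∘ ends
      ; endpoint-u = ends⁻ (inj₂ refl) ; endpoint-w = ends⁻ (inj₁ refl)
      ; joins = λ l → let l′ , merge = bridges⇒joinsʳ bridges l in l′ , λ R₁ R₂ c₁ c₂ →
          let merged M₁ M₂ cyc perm = merge R₁ R₂ c₁ c₂ in merged M₁ M₂ cyc
          (↭-trans perm (++⁺ˡ (seg w l (d i) ++ R₁) (++⁺ˡ (seg h l′ (d i) ++ R₂) (fibs-resp-↭ (↭-sym (↭-reverse q))))))
      ; σL-w = Bridges.σL-h bridges }

  traversal-from : ∀ {i u} → T (isEndpoint (Q i) u) → ∃[ w ] Traversal i u w
  traversal-from {i} ep with h , w , forward , backward ← traversals i with Traversal.endpoint forward ep
  ... | inj₁ refl = w , forward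
  ... | inj₂ refl = h , backward

  endpoint∈ : ∀ {i u} → T (isEndpoint (Q i) u) → u ∈ Q i
  endpoint∈ ep = ∈-resp-↭ (↭-sym (Traversal.members (proj₂ (traversal-from ep)))) (here refl)

-- Growing one cycle along the tree

module Growth {V n : ℕ} .{{_ : NonZero n}} {G : SimpleGraph V} (tree : IsTree G) (σ : Voltage V n G)
  (r : Fin n) (coprime : Coprime (toℕ r) n) (k : ℕ) (Q : Fin k → List (Fin V))
  (decomposition : OddShiftingDecomposition σ k Q r) (weighted : ProperlyWeighted σ k Q) where
  open Assembly σ r coprime k Q decomposition
  open DecMembership (_≟_ {k}) using (_∈?_)

  edge-covered : ∀ {u v} → Adj u v → ∃[ i ] Edge i u v
  edge-covered {u} {v} = proj₁ (proj₂ decomposition) u v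

  edge-unique : ∀ {u v i j} → Edge i u v → Edge j u v → i ≡ j
  edge-unique {u} {v} {i} {j} = proj₁ (proj₂ (proj₂ decomposition)) u v i j

  shared-endpoint : ∀ {i j v} → i ≢ j → v ∈ Q i → v ∈ Q j → T (isEndpoint (Q i) v) × T (isEndpoint (Q j) v)
  shared-endpoint {i} {j} {v} i≢j = proj₂ (proj₂ (proj₂ decomposition)) i j i≢j v

  EdgeOf : List (Fin k) → Fin V → Fin V → Set
  EdgeOf S u v = ∃[ i ] i ∈ S × Edge i u v

  EdgeOf-sym : ∀ {S u v} → EdgeOf S u v → EdgeOf S v u
  EdgeOf-sym (i , i∈ , e) = i , i∈ , Sum.swap e

  -- S lists the paths already merged into the cycle, U the vertices of T whose fibres it covers.
  record Partial (U : List (Fin V)) (S : List (Fin k)) : Set where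
    field
      items     : List Item
      cyclic    : Cyc Adjᴸ (flat items)
      covers    : flat items ↭ fibs U
      slots     : ∀ {i v} → i ∉ S → v ∈ U → T (isEndpoint (Q i) v) → ∃[ l ] slot i v l ∈ items
      distinctU : Unique U
      ends      : ∀ {i v} → i ∉ S → v ∈ U → v ∈ Q i → T (isEndpoint (Q i) v)
      closed    : ∀ {i v} → i ∈ S → v ∈ Q i → v ∈ U
      root      : Fin V
      root∈     : root ∈ U
      connected : ∀ {v} → v ∈ U → Star (EdgeOf S) root v

  initial : Fin k → ∃[ u ] Partial [ u ] []
  initial i with u , w , _ , backward ← traversals i = u , record
      { items = items ; cyclic = cyclic ; covers = ↭-trans covers (↭-reflexive (sym (++-identityʳ (fib u))))
      ; slots = λ { _ (here refl) ep → slots ep }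
      ; distinctU = [] ∷ []
      ; ends = λ { {j} _ (here refl) u∈ → end-at j u∈ }
      ; closed = λ () ; root = u ; root∈ = here refl ; connected = λ { (here refl) → ε } }
    where
    open FibreItems (fibre-items (Traversal.σL-w backward)
      (weighted u (i , Traversal.endpoint-w backward)) (Traversal.endpoint-w backward) 0ₙ)
    end-at : ∀ j → u ∈ Q j → T (isEndpoint (Q j) u)
    end-at j u∈ with j ≟ i
    ... | yes refl = Traversal.endpoint-w backward
    ... | no j≢i   = proj₁ (shared-endpoint j≢i u∈ (endpoint∈ (Traversal.endpoint-w backward)))

  module _ {U S} (partial : Partial U S) where
    open Partial partial

    edgeOf-target : ∀ {u v} → EdgeOf S u v → v ∈ U
    edgeOf-target (i , i∈ , e) = closed i∈ (proj₂ (edgeIn⇒∈ (Q i) e))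

    -- On a walk of T from the root to an end of `Q i₀`, the edges of merged paths never leave `U`,
    -- by `closed`. The first other edge starts in `U` and gives the path; if there is none, the
    -- walk ends in `U` and `Q i₀` itself is attached there.
    attached : ∀ {i₀} → i₀ ∉ S → ∃[ i ] ∃[ u ] i ∉ S × u ∈ U × u ∈ Q i
    attached {i₀} i₀∉ with h , _ , forward , _ ← traversals i₀ = search root∈ (proj₁ tree root h)
      where
      search : ∀ {u} → u ∈ U → Walk G u h → ∃[ i ] ∃[ u ] i ∉ S × u ∈ U × u ∈ Q i
      search u∈ here = i₀ , h , i₀∉ , u∈ , endpoint∈ (Traversal.endpoint-u forward)
      search {u} u∈ (step uw walk) with j , e ← edge-covered uw with j ∈? S
      ... | yes j∈ = search (closed j∈ (proj₂ (edgeIn⇒∈ (Q j) e))) walk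
      ... | no  j∉ = j , u , j∉ , u∈ , proj₁ (edgeIn⇒∈ (Q j) e)

    complete⇒all : (∀ i → i ∈ S) → ∀ v → v ∈ U
    complete⇒all all∈ v = follow root∈ (proj₁ tree root v)
      where
      follow : ∀ {u} → u ∈ U → Walk G u v → v ∈ U
      follow u∈ here = u∈
      follow u∈ (step uw walk) with j , e ← edge-covered uw =
        follow (closed (all∈ j) (proj₂ (edgeIn⇒∈ (Q j) e))) walk

    module _ {i u w} (i∉ : i ∉ S) (u∈ : u ∈ U) (tr : Traversal i u w) where
      open Traversal tr

      inner∉U : ∀ {v} → v ∈ inner → v ∉ U
      inner∉U v∈ v∈U = inner-not-endpoint v∈ (ends i∉ v∈U (inner∈ v∈))

      -- Otherwise the new path and a path through the covered part would close up to a cycle of the tree.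
      w∉U : w ∉ U
      w∉U w∈U with star⇒simplePath (Star.reverse EdgeOf-sym (connected w∈U) ◅◅ connected u∈)
      ... | inj₁ w≡u = u≢w (sym w≡u)
      ... | inj₂ (p , pth , w∷p∷u-unique) = proj₂ tree (u ∷ inner ++ w ∷ p)
        ( long inner p edges pth
        , Unique.++⁺ {xs = u ∷ inner} u∷inner-unique (proj₁ (unique-∷ʳ (w ∷ p) w∷p∷u-unique)) disjoint
        , cyc⇒cyclicallyLinked (u ∷ inner ++ w ∷ p)
            (path-++ inner (path-mono (edge-Adj i) inner edges) (path-mono (λ (j , _ , e) → edge-Adj j e) p pth)))
        where
        long : ∀ q p → Path (Edge i) u q w → Path (EdgeOf S) w p u → 3 ≤ length (u ∷ q ++ w ∷ p)
        -- Two single edges would not form a cycle, but then the edge uw would lie both on `Q i` and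
        -- on a merged path, against the partition of the edges.
        long []      []      e (j , j∈ , e′) = ⊥-elim (i∉ (subst (_∈ S) (edge-unique (Sum.swap e′) e) j∈))
        long []      (_ ∷ _) _ _ = s≤s (s≤s (s≤s z≤n))
        long (_ ∷ q) p       _ _ = s≤s (s≤s (subst (1 ≤_) (sym (length-++ q)) (≤-trans (s≤s z≤n) (m≤n+m _ (length q)))))
        u∷inner-unique : Unique (u ∷ inner)
        u∷inner-unique with (_ ∷ u∉) ∷ (_ ∷ uq) ← distinct = u∉ ∷ uq
        disjoint : ∀ {v} → ¬ (v ∈ u ∷ inner × v ∈ w ∷ p)
        disjoint (here refl , v∈)         = proj₂ (unique-∷ʳ (w ∷ p) w∷p∷u-unique) v∈
        disjoint (there v∈ , here refl)   = inner∉U v∈ w∈U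
        disjoint (there v∈ , there v∈p)   = inner∉U v∈ (path-targets edgeOf-target p pth v∈p)

      extend : Partial (U ++ w ∷ inner) (i ∷ S)
      extend = record
        { items = new
        ; cyclic = subst (Cyc Adjᴸ) (sym flat-new) M.cyclic
        ; covers = begin
            flat new                                ≡⟨ flat-new ⟩
            M.M₁ ++ flat I₂ ++ M.M₂ ++ flat I₁      ↭⟨ M.covers ⟩
            (seg u l (d i) ++ flat I₁) ++ (seg w l′ (d i) ++ flat I₂) ++ fibs inner
              ↭⟨ ++⁺ (↭-trans (↭-sym P₁.splits) covers) (++⁺ʳ (fibs inner) (↭-trans (↭-sym P₂.splits) F.covers)) ⟩
            fibs U ++ fib w ++ fibs inner           ≡⟨ concatMap-++ fib U (w ∷ inner) ⟨
            fibs (U ++ w ∷ inner)                   ∎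
        ; slots = new-slots
        ; distinctU = Unique.++⁺ distinctU w∷inner-unique
            (λ { (v∈ , here refl) → w∉U v∈ ; (v∈ , there v∈′) → inner∉U v∈′ v∈ })
        ; ends = new-ends
        ; closed = λ { (here refl) v∈ → covered v∈ ; (there j∈) v∈ → ∈-++⁺ˡ (closed j∈ v∈) }
        ; root = root
        ; root∈ = ∈-++⁺ˡ root∈
        ; connected = λ v∈ → new-connected (∈-++⁻ U v∈)
        }
        where
        open PermutationReasoning
        l l′ : Z
        l  = proj₁ (slots i∉ u∈ endpoint-u)
        l′ = proj₁ (joins l)
        module P₁ = Pulled (pull-slot items (proj₂ (slots i∉ u∈ endpoint-u)) cyclic)
        module F = FibreItems (fibre-items σL-w (weighted w (i , endpoint-w)) endpoint-w l′)
        module P₂ = Pulled (pull-slot F.items F.anchor F.cyclic)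
        I₁ I₂ new : List Item
        I₁ = P₁.others
        I₂ = P₂.others
        module M = Merged (proj₂ (joins l) (flat I₁) (flat I₂) P₁.cyclic P₂.cyclic)
        new = map vertex M.M₁ ++ I₂ ++ map vertex M.M₂ ++ I₁

        flat-new : flat new ≡ M.M₁ ++ flat I₂ ++ M.M₂ ++ flat I₁
        flat-new = trans (concatMap-++ expand (map vertex M.M₁) _) (cong₂ _++_ (flat-vertex M.M₁)
          (trans (concatMap-++ expand I₂ _) (cong (flat I₂ ++_)
            (trans (concatMap-++ expand (map vertex M.M₂) I₁) (cong (_++ flat I₁) (flat-vertex M.M₂))))))

        w∷inner-unique : Unique (w ∷ inner)
        w∷inner-unique with _ ∷ uq ← distinct = uq

        covered : ∀ {v} → v ∈ Q i → v ∈ U ++ w ∷ inner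
        covered v∈ with ∈-resp-↭ members v∈
        ... | here refl = ∈-++⁺ˡ u∈
        ... | there v∈′ = ∈-++⁺ʳ U v∈′

        w∷inner∈ : ∀ {v} → v ∈ w ∷ inner → v ∈ Q i
        w∷inner∈ v∈ = ∈-resp-↭ (↭-sym members) (there v∈)

        new-ends : ∀ {j v} → j ∉ i ∷ S → v ∈ U ++ w ∷ inner → v ∈ Q j → T (isEndpoint (Q j) v)
        new-ends j∉ v∈ v∈Qj with ∈-++⁻ U v∈
        ... | inj₁ v∈U = ends (j∉ ∘ there) v∈U v∈Qj
        ... | inj₂ v∈′ = proj₁ (shared-endpoint (j∉ ∘ here) v∈Qj (w∷inner∈ v∈′))

        new-slots : ∀ {j v} → j ∉ i ∷ S → v ∈ U ++ w ∷ inner → T (isEndpoint (Q j) v) → ∃[ m ] slot j v m ∈ new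
        new-slots j∉ v∈ ep with ∈-++⁻ U v∈
        ... | inj₁ v∈U = let m , m∈ = slots (j∉ ∘ there) v∈U ep in
          m , ∈-++⁺ʳ (map vertex M.M₁) (∈-++⁺ʳ I₂ (∈-++⁺ʳ (map vertex M.M₂) (P₁.keeps (j∉ ∘ here) m∈)))
        ... | inj₂ (here refl) = let m , m∈ = F.slots ep in
          m , ∈-++⁺ʳ (map vertex M.M₁) (∈-++⁺ˡ (P₂.keeps (j∉ ∘ here) m∈))
        -- An inner vertex of `Q i` lies on no other path, since a shared vertex is an endpoint of
        -- both. Fibres consumed by bridges thus never owe a slot.
        ... | inj₂ (there v∈′) = ⊥-elim (inner-not-endpoint v∈′
          (proj₂ (shared-endpoint (j∉ ∘ here) (endpoint∈ ep) (inner∈ v∈′))))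

        new-connected : ∀ {v} → v ∈ U ⊎ v ∈ w ∷ inner → Star (EdgeOf (i ∷ S)) root v
        new-connected (inj₁ v∈) = Star.map (λ (j , j∈ , e) → j , there j∈ , e) (connected v∈)
        new-connected (inj₂ v∈) = new-connected (inj₁ u∈) ◅◅
          path⇒star inner (path-mono (λ e → i , here refl , e) inner edges) (rotate v∈)
          where
          rotate : ∀ {v} → v ∈ w ∷ inner → v ∈ inner ++ [ w ]
          rotate (here refl) = ∈-++⁺ʳ inner (here refl)
          rotate (there v∈)  = ∈-++⁺ˡ v∈

  Complete : Set
  Complete = ∃[ U ] ∃[ S ] Partial U S × (∀ i → i ∈ S)

  grow : ∀ fuel todo {U S} → length todo ≤ fuel → (∀ i → i ∉ S → i ∈ todo) → Partial U S → Complete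
  grow fuel todo {U} {S} len rest partial with any? (λ i → ¬? (i ∈? S))
  ... | no none = U , S , partial , λ i → decidable-stable (i ∈? S) (λ i∉ → none (i , i∉))
  ... | yes (i₀ , i₀∉) with i , u , i∉ , u∈ , u∈Q ← attached partial i₀∉ with fuel
  ...   | zero with [] ← todo with () ← rest i i∉
  ...   | suc fuel′ = grow fuel′ (filter (λ j → ¬? (j ≟ i)) todo)
      (≤-pred (≤-trans (filter-notAll (λ j → ¬? (j ≟ i)) todo (lose (rest i i∉) (λ i≢i → i≢i refl))) len))
      (λ j j∉ → ∈-filter⁺ (λ j → ¬? (j ≟ i)) (rest j (j∉ ∘ there)) (j∉ ∘ here))
      (extend partial i∉ u∈ (proj₂ (traversal-from (Partial.ends partial i∉ u∈ u∈Q))))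

  length-fibs : ∀ U → length (fibs U) ≡ length U * n
  length-fibs []      = refl
  length-fibs (v ∷ U) = trans (length-++ (fib v)) (cong₂ _+_ (trans (length-map (v ,_) (allFin n)) (length-tabulate id)) (length-fibs U))

  two≤length : ∀ {A : Set} {u w : A} {U} → u ≢ w → u ∈ U → w ∈ U → 2 ≤ length U
  two≤length {U = _ ∷ []}     u≢w (here refl) (here refl) = ⊥-elim (u≢w refl)
  two≤length {U = _ ∷ _ ∷ _}  _   _           _           = s≤s (s≤s z≤n)

  hamiltonian : Fin k → LiftHamiltonian σ
  hamiltonian i =
    flat items , long , Unique-resp-↭ (↭-sym covers) fibs-unique ,
    (λ (v , z) → ∈-resp-↭ (↭-sym covers) (∈-concatMap⁺ fib (lose (everywhere v) (∈-fib v z)))) ,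
    cyc⇒cyclicallyLinked (flat items) cyclic
    where
    complete : Complete
    complete = grow k (allFin k) (≤-reflexive (length-tabulate id)) (λ j _ → ∈-allFin j) (proj₂ (initial i))
    U : List (Fin V)
    U = proj₁ complete
    partial : Partial U (proj₁ (proj₂ complete))
    partial = proj₁ (proj₂ (proj₂ complete))
    open Partial partial
    everywhere : ∀ v → v ∈ U
    everywhere = complete⇒all partial (proj₂ (proj₂ (proj₂ complete)))
    fibs-unique : Unique (fibs U)
    fibs-unique = unique-concatMap fib (λ {v} _ → fib-unique v)
      (λ _ _ p q → trans (sym (∈-fib⁻ p)) (∈-fib⁻ q)) distinctU
    2≤n : 2 ≤ n
    2≤n with os@(_ , _ , _ , _ , s , _ , 0<s , s<d , _) ← proj₂ (proj₁ decomposition i) =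
      ≤-trans (≤-trans (s≤s 0<s) s<d) (2cval≤n (Q i) os)
    -- The two ends of `Q i` are distinct vertices of T, and 0 < s < d ≤ n makes each fibre have at
    -- least two vertices, so the cycle has at least four.
    long : 3 ≤ length (flat items)
    long = ≤-trans (n≤1+n 3) (subst (4 ≤_) (sym (trans (↭-length covers) (length-fibs U)))
      (*-mono-≤ (two≤length (Traversal.u≢w (proj₁ (proj₂ (proj₂ (traversals i))))) (everywhere _) (everywhere _)) 2≤n))

theorem2 : (V n : ℕ) .{{_ : NonZero n}} (G : SimpleGraph V) → IsTree G →
    (σ : Voltage V n G) → (k : ℕ) → 1 ≤ k → (Q : Fin k → Data.List.List (Fin V)) → (r : Fin n) →
    Coprime (toℕ r) n → OddShiftingDecomposition σ k Q r →
    ProperlyWeighted σ k Q → LiftHamiltonian σ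
theorem2 V n G tree σ (suc k) _ Q r coprime decomposition weighted =
  Growth.hamiltonian tree σ r coprime (suc k) Q decomposition weighted Data.Fin.zero
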